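{- Let ${\sf Perfect}_{\sf bin}$ be the following formula about a binary tree $T\subseteq2^{<\omega}$: $$\forall\sigma\in T\ \big[{\sf Ext}(\sigma,T)\to\exists\tau_0,\tau_1\in T\ (\tau_0,\tau_1\text{ extend }\sigma\ \wedge\ \tau_0\bot\tau_1\ \wedge\ \forall i<2.\ {\sf Ext}(\tau_i,T))\big],$$ where ${\sf Ext}(\sigma,T)\equiv\forall\ell\,\exists\tau\in2^\ell.\ \sigma^\frown\tau\in T$ and $\tau_0\bot\tau_1$ means that $\tau_0,\tau_1$ are incomparable. Then ${\sf Perfect}_{\sf bin}$ is $\forall^\to\exists\forall$-dicomplete.
   Context: Number quantifiers range over $\omega$. Instances are tuples of natural numbers and/or total computable functions (computable elements of $\omega^\omega$); spaces such as $\omega\times\omega^\omega$, $(\omega^\omega)^\omega$ are identified with $\omega^\omega$ by computable pairing. A tree $T\subseteq2^{<\omega}$ is a set of (coded) finite binary strings closed under initial segments, given by its characteristic function; instances of ${\sf Perfect}_{\sf bin}$ are (computable) codes of such trees. In ${\sf Ext}$ the quantifier over $\tau\in2^\ell$ is bounded, so ${\sf Ext}$ is a $\forall$-formula. A $\forall^\to\exists\forall$-formula is a formula of the form $\forall a[\forall b\,\gamma(a,b,x)\to\exists c\,\forall d\,\theta(a,c,d,x)]$ with $\gamma,\theta$ bounded formulas. Its dual, a $\exists^\wedge\forall\exists$-formula, is $\exists a[\forall b\,\gamma(a,b,x)\wedge\forall c\,\exists d\,\neg\theta(a,c,d,x)]$. ${\sf Perfect}_{\sf bin}$ is put in this form with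 $a=\sigma$, $c=(\tau_0,\tau_1)$ (conditions of membership in $T$ being decidable). Witnesses (in simplified form, omitting computably recoverable information): a witness for $\forall a[\forall b\,\gamma\to\exists c\,\forall d\,\theta]$ at $x$ is a partial function $f:\omega\rightharpoonup\omega$, presented by an element of $\omega^\omega$ enumerating its graph, such that for every $a$ with $\forall b\,\gamma(a,b,x)$, $f(a)$ is defined and $\forall d\,\theta(a,f(a),d,x)$. A witness for the dual at $x$ is a number $a$ with $\forall b\,\gamma(a,b,x)\wedge\forall c\,\exists d\,\neg\theta(a,c,d,x)$. Reducibility: $\varphi\le_{\sf m}\psi$ if there are computable functions $\eta,r_-,r_+$ (type-two computable functionals, possibly partial but defined wherever required) such that for every instance $x$ of $\varphi$, $\eta(x)$ is an instance of $\psi$; $\varphi(x)$ is true iff $\psi(\eta(x))$ is true; if $\alpha$ is a witness for $\varphi(x)$ then $r_-(\alpha,x)$ is a witness for $\psi(\eta(x))$; if $\alpha$ is a witness for $\psi(\eta(x))$ then $r_+(\alpha,x)$ is a witness for $\varphi(x)$. $\varphi\le_{\sf dm}\psi$ if $\varphi\le_{\sf m}\psi$ and $\varphi^{\sf d}\le_{\sf m}\psi^{\sf d}$ via a common $\eta$ (the $r_\pm$ may differ), where $^{\sf d}$ denotes the dual. A formula is strictly $\forall^\to\exists\forall$-dicomplete if it is a $\forall^\to\exists\forall$-formula and every $\forall^\to\exists\forall$-formula is $\le_{\sf dm}$-reducible to it; it is $\forall^\to\exists\forall$-dicomplete if it is $\equiv_{\sf dm}$-equivalent to a strictly $\forall^\to\exists\forall$-dicomplete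 formula. -}

module Defs where

open import Data.Bool using (Bool; true; false)
open import Data.Empty using (⊥-elim)
open import Data.Fin using (Fin; zero; suc)
open import Data.List as List using (List; []; _∷_)
open import Data.List.Relation.Binary.Prefix.Heterogeneous using (Prefix)
open import Data.Nat using (ℕ; zero; suc; _+_; _*_; _≤_; _<_; z≤n; s≤s)
open import Data.Nat.Properties
open import Data.Product using (Σ; ∃; ∃-syntax; _×_; _,_; proj₁; proj₂)
open import Data.Unit using (⊤)
open import Data.Sum using (_⊎_; inj₁; inj₂)
open import Data.Vec as Vec using (Vec; []; _∷_; lookup; tabulate; _++_)
open import Data.Vec.Functional using (Vector)
open import Function.Bundles using (_⇔_; mk⇔)
open import Relation.Binary using (tri<; tri≈; tri>)
open import Relation.Binary.PropositionalEquality
open import Relation.Nullary using (¬_)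

-- Cantor's pairing function.
triangle : ℕ → ℕ
triangle zero    = 0
triangle (suc n) = suc n + triangle n

pair : ℕ → ℕ → ℕ
pair a b = triangle (a + b) + b

Str : Set
Str = List Bool

-- Bijective base 2, least significant digit first: a bijection Str → ℕ.
code : Str → ℕ
code []          = 0
code (false ∷ σ) = 1 + 2 * code σ
code (true  ∷ σ) = 2 + 2 * code σ

data PrimRec : ℕ → Set where
  zeroᵖ : PrimRec 0
  sucᵖ  : PrimRec 1
  projᵖ : ∀ {n} → Fin n → PrimRec n
  compᵖ : ∀ {k n} → PrimRec k → Vector (PrimRec n) k → PrimRec n
  recᵖ  : ∀ {n} → PrimRec n → PrimRec (2 + n) → PrimRec (1 + n)

⟦_⟧ᵖ : ∀ {n} → PrimRec n → Vec ℕ n → ℕ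
⟦ zeroᵖ ⟧ᵖ      []           = 0
⟦ sucᵖ ⟧ᵖ       (x ∷ [])     = suc x
⟦ projᵖ i ⟧ᵖ    xs           = lookup xs i
⟦ compᵖ f gs ⟧ᵖ xs           = ⟦ f ⟧ᵖ (tabulate λ i → ⟦ gs i ⟧ᵖ xs)
⟦ recᵖ g h ⟧ᵖ   (zero ∷ xs)  = ⟦ g ⟧ᵖ xs
⟦ recᵖ g h ⟧ᵖ   (suc n ∷ xs) = ⟦ h ⟧ᵖ (n ∷ ⟦ recᵖ g h ⟧ᵖ (n ∷ xs) ∷ xs)

-- Partial recursive functions of n numbers relative to m function oracles.
data Code (m : ℕ) : ℕ → Set where
  prim   : ∀ {n} → PrimRec n → Code m n
  oracle : Fin m → Code m 1
  comp   : ∀ {k n} → Code m k → Vector (Code m n) k → Code m n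
  rec    : ∀ {n} → Code m n → Code m (2 + n) → Code m (1 + n)
  μ      : ∀ {n} → Code m (1 + n) → Code m n

infix 4 _[_]_⇓_

-- c [ αs ] xs ⇓ y : program c with oracles αs halts on input xs with output y.
data _[_]_⇓_ {m : ℕ} : ∀ {n} → Code m n → Vec (ℕ → ℕ) m → Vec ℕ n → ℕ → Set where
  ⇓prim   : ∀ {n αs} {p : PrimRec n} {xs} → prim p [ αs ] xs ⇓ ⟦ p ⟧ᵖ xs
  ⇓oracle : ∀ {αs i x} → oracle i [ αs ] (x ∷ []) ⇓ lookup αs i x
  ⇓comp   : ∀ {k n αs xs y} {f : Code m k} {gs : Vector (Code m n) k} (zs : Vec ℕ k) →
            (∀ i → gs i [ αs ] xs ⇓ lookup zs i) →
            f [ αs ] zs ⇓ y →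
            comp f gs [ αs ] xs ⇓ y
  ⇓rec0   : ∀ {n αs xs y} {g : Code m n} {h : Code m (2 + n)} →
            g [ αs ] xs ⇓ y →
            rec g h [ αs ] (0 ∷ xs) ⇓ y
  ⇓recS   : ∀ {n αs xs x z y} {g : Code m n} {h : Code m (2 + n)} →
            rec g h [ αs ] (x ∷ xs) ⇓ z →
            h [ αs ] (x ∷ z ∷ xs) ⇓ y →
            rec g h [ αs ] (suc x ∷ xs) ⇓ y
  ⇓μ      : ∀ {n αs xs y} {f : Code m (1 + n)} →
            f [ αs ] (y ∷ xs) ⇓ 0 →
            (∀ z → z < y → ∃[ w ] f [ αs ] (z ∷ xs) ⇓ suc w) →
            μ f [ αs ] xs ⇓ y

ComputableFn : (ℕ → ℕ) → Set
ComputableFn f = ∃[ c ] ∀ n → _[_]_⇓_ {0} c [] (n ∷ []) (f n)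

record Shape : Set where
  constructor ⟨_,_⟩
  field
    #nums : ℕ
    #funs : ℕ
open Shape public

Tuple : Shape → Set
Tuple s = Vec ℕ (#nums s) × Vec (ℕ → ℕ) (#funs s)

_⊕_ : Shape → Shape → Shape
⟨ k , m ⟩ ⊕ ⟨ k′ , m′ ⟩ = ⟨ k + k′ , m + m′ ⟩

_▹_ : ∀ {s t} → Tuple s → Tuple t → Tuple (s ⊕ t)
(xs , αs) ▹ (ys , βs) = (xs ++ ys) , (αs ++ βs)

ComputableTuple : ∀ {s} → Tuple s → Set
ComputableTuple (_ , αs) = ∀ i → ComputableFn (lookup αs i)

-- The function components of the input are available as oracles.  An output
-- function is given by a program taking its argument as an extra first input.
record Functional (s t : Shape) : Set where
  field
    nums : Vector (Code (#funs s) (#nums s)) (#nums t)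
    funs : Vector (Code (#funs s) (1 + #nums s)) (#funs t)
open Functional public

infix 4 _·_↦_

-- F · x ↦ y : the partial functional F is defined at x, with value y.
_·_↦_ : ∀ {s t} → Functional s t → Tuple s → Tuple t → Set
F · (xs , αs) ↦ (ys , βs) =
  (∀ i → nums F i [ αs ] xs ⇓ lookup ys i) ×
  (∀ j n → funs F j [ αs ] (n ∷ xs) ⇓ lookup βs j n)

record Problem : Set₁ where
  field
    shape      : Shape
    witShape   : Shape
    IsInstance : Tuple shape → Set
    True       : Tuple shape → Set
    IsWitness  : Tuple witShape → Tuple shape → Set

module _ (P Q : Problem) where
  private
    module P = Problem P
    module Q = Problem Q

  ReducesVia : Functional P.shape Q.shape → Set
  ReducesVia η =
    Σ (Functional (P.witShape ⊕ P.shape) Q.witShape) λ r₋ →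
    Σ (Functional (Q.witShape ⊕ P.shape) P.witShape) λ r₊ →
    ∀ x → P.IsInstance x →
    ∃[ y ] (η · x ↦ y) ×
           Q.IsInstance y ×
           (P.True x ⇔ Q.True y) ×
           (∀ α → P.IsWitness α x → ∃[ β ] (r₋ · (α ▹ x) ↦ β) × Q.IsWitness β y) ×
           (∀ α → Q.IsWitness α y → ∃[ β ] (r₊ · (α ▹ x) ↦ β) × P.IsWitness β x)

  infix 4 _≤m_
  _≤m_ : Set
  _≤m_ = ∃[ η ] ReducesVia η

-- ∀a[∀b γ(a,b,x) → ∃c ∀d θ(a,c,d,x)], with γ and θ given by their meaning; Dom restricts the computable tuples
-- allowed as instances.
record Form : Set₁ where
  field
    shape : Shape
    Dom   : Tuple shape → Set
    γ     : (a b : ℕ) → Tuple shape → Set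
    θ     : (a c d : ℕ) → Tuple shape → Set

-- The partial function whose graph is enumerated by α: the value 0 enumerates
-- nothing, so that partial functions with empty graph are also presented.
_∋_↦_ : (ℕ → ℕ) → ℕ → ℕ → Set
α ∋ a ↦ c = ∃[ n ] α n ≡ suc (pair a c)

IsPartialFunction : (ℕ → ℕ) → Set
IsPartialFunction α =
  (∀ n → α n ≡ 0 ⊎ ∃[ a ] ∃[ c ] α n ≡ suc (pair a c)) ×
  (∀ a c c′ → α ∋ a ↦ c → α ∋ a ↦ c′ → c ≡ c′)

module _ (φ : Form) where
  open Form φ

  problem : Problem
  problem = record
    { shape      = shape
    ; witShape   = ⟨ 0 , 1 ⟩
    ; IsInstance = λ x → ComputableTuple {shape} x × Dom x
    ; True       = λ x → ∀ a → (∀ b → γ a b x) → ∃[ c ] ∀ d → θ a c d x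
    ; IsWitness  = λ { ([] , α ∷ []) x →
        IsPartialFunction α ×
        (∀ a → (∀ b → γ a b x) → ∃[ c ] (α ∋ a ↦ c) × (∀ d → θ a c d x)) }
    }

  dual : Problem
  dual = record
    { shape      = shape
    ; witShape   = ⟨ 1 , 0 ⟩
    ; IsInstance = λ x → ComputableTuple {shape} x × Dom x
    ; True       = λ x → ∃[ a ] (∀ b → γ a b x) × (∀ c → ∃[ d ] ¬ θ a c d x)
    ; IsWitness  = λ { (a ∷ [] , []) x →
        (∀ b → γ a b x) × (∀ c → ∃[ d ] ¬ θ a c d x) }
    }

infix 4 _≤dm_ _≡dm_

_≤dm_ : Form → Form → Set
φ ≤dm ψ = ∃[ η ] ReducesVia (problem φ) (problem ψ) η × ReducesVia (dual φ) (dual ψ) η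

_≡dm_ : Form → Form → Set
φ ≡dm ψ = φ ≤dm ψ × ψ ≤dm φ

-- Bounded formulas of arithmetic with number variables Fin n and function
-- parameters Fin m, over all primitive recursive function symbols.  Bounded
-- quantifiers bind variable zero and range below the value of the term.
data Term (m n : ℕ) : Set where
  var : Fin n → Term m n
  fun : ∀ {k} → PrimRec k → Vector (Term m n) k → Term m n
  app : Fin m → Term m n → Term m n

data Bounded (m : ℕ) : ℕ → Set where
  _≐_         : ∀ {n} → Term m n → Term m n → Bounded m n
  ¬′_         : ∀ {n} → Bounded m n → Bounded m n
  _∧′_ _∨′_ _⇒′_ : ∀ {n} → Bounded m n → Bounded m n → Bounded m n
  ∀<_·_ ∃<_·_ : ∀ {n} → Term m n → Bounded m (suc n) → Bounded m n

⟦_⟧ᵗ : ∀ {m n} → Term m n → Vec (ℕ → ℕ) m → Vec ℕ n → ℕ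
⟦ var i ⟧ᵗ    αs xs = lookup xs i
⟦ fun p ts ⟧ᵗ αs xs = ⟦ p ⟧ᵖ (tabulate λ i → ⟦ ts i ⟧ᵗ αs xs)
⟦ app j t ⟧ᵗ  αs xs = lookup αs j (⟦ t ⟧ᵗ αs xs)

⟦_⟧ᵇ : ∀ {m n} → Bounded m n → Vec (ℕ → ℕ) m → Vec ℕ n → Set
⟦ s ≐ t ⟧ᵇ    αs xs = ⟦ s ⟧ᵗ αs xs ≡ ⟦ t ⟧ᵗ αs xs
⟦ ¬′ φ ⟧ᵇ     αs xs = ¬ ⟦ φ ⟧ᵇ αs xs
⟦ φ ∧′ ψ ⟧ᵇ   αs xs = ⟦ φ ⟧ᵇ αs xs × ⟦ ψ ⟧ᵇ αs xs
⟦ φ ∨′ ψ ⟧ᵇ   αs xs = ⟦ φ ⟧ᵇ αs xs ⊎ ⟦ ψ ⟧ᵇ αs xs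
⟦ φ ⇒′ ψ ⟧ᵇ   αs xs = ⟦ φ ⟧ᵇ αs xs → ⟦ ψ ⟧ᵇ αs xs
⟦ ∀< t · φ ⟧ᵇ αs xs = ∀ i → i < ⟦ t ⟧ᵗ αs xs → ⟦ φ ⟧ᵇ αs (i ∷ xs)
⟦ ∃< t · φ ⟧ᵇ αs xs = ∃[ i ] i < ⟦ t ⟧ᵗ αs xs × ⟦ φ ⟧ᵇ αs (i ∷ xs)

-- Number variables, in order: a, b, x in γ and a, c, d, x in θ.
record ∀→∃∀-Formula : Set where
  field
    shape : Shape
    γ     : Bounded (#funs shape) (2 + #nums shape)
    θ     : Bounded (#funs shape) (3 + #nums shape)

  form : Form
  form = record
    { shape = shape
    ; Dom   = λ _ → ⊤
    ; γ     = λ { a b (xs , αs) → ⟦ γ ⟧ᵇ αs (a ∷ b ∷ xs) }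
    ; θ     = λ { a c d (xs , αs) → ⟦ θ ⟧ᵇ αs (a ∷ c ∷ d ∷ xs) }
    }
open ∀→∃∀-Formula public using (form)

StrictlyDicomplete : ∀→∃∀-Formula → Set
StrictlyDicomplete ψ = ∀ (χ : ∀→∃∀-Formula) → form χ ≤dm form ψ

Dicomplete : Form → Set
Dicomplete φ = ∃[ ψ ] StrictlyDicomplete ψ × φ ≡dm form ψ

infix 4 _∈_ _⊑_ _⊥_

_∈_ : Str → (ℕ → ℕ) → Set
σ ∈ T = T (code σ) ≡ 1

_⊑_ : Str → Str → Set
_⊑_ = Prefix _≡_

_⊥_ : Str → Str → Set
σ ⊥ τ = ¬ σ ⊑ τ × ¬ τ ⊑ σ

IsTree : (ℕ → ℕ) → Set
IsTree T = (∀ n → T n ≡ 0 ⊎ T n ≡ 1) × (∀ σ τ → σ ⊑ τ → τ ∈ T → σ ∈ T)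

-- The matrix of Ext: some τ ∈ 2^ℓ has σ⌢τ ∈ T.
ExtAt : ℕ → Str → (ℕ → ℕ) → Set
ExtAt ℓ σ T = Σ (Vec Bool ℓ) λ τ → σ List.++ Vec.toList τ ∈ T

Ext : Str → (ℕ → ℕ) → Set
Ext σ T = ∀ ℓ → ExtAt ℓ σ T

IsPerfect : (ℕ → ℕ) → Set
IsPerfect T = ∀ σ → σ ∈ T → Ext σ T →
  ∃[ τ₀ ] ∃[ τ₁ ] τ₀ ∈ T × τ₁ ∈ T × (σ ⊑ τ₀ × σ ⊑ τ₁) × τ₀ ⊥ τ₁ × (Ext τ₀ T × Ext τ₁ T)

-- IsPerfect in the form ∀a[∀b γ → ∃c ∀d θ] with a = σ, b = ℓ, c = (τ₀,τ₁) and
-- d = ℓ; see Perfect-bin-correct.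
Perfect-bin : Form
Perfect-bin = record
  { shape = ⟨ 0 , 1 ⟩
  ; Dom   = λ { ([] , T ∷ []) → IsTree T }
  ; γ     = λ { a ℓ ([] , T ∷ []) → ∃[ σ ] a ≡ code σ × σ ∈ T × ExtAt ℓ σ T }
  ; θ     = λ { a c ℓ ([] , T ∷ []) →
      ∃[ σ ] ∃[ τ₀ ] ∃[ τ₁ ] a ≡ code σ × c ≡ pair (code τ₀) (code τ₁) ×
        τ₀ ∈ T × τ₁ ∈ T × (σ ⊑ τ₀ × σ ⊑ τ₁) × τ₀ ⊥ τ₁ × (ExtAt ℓ τ₀ T × ExtAt ℓ τ₁ T) }
  }

code-injective : ∀ σ τ → code σ ≡ code τ → σ ≡ τ
code-injective []          []          eq = refl
code-injective []          (false ∷ τ) ()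
code-injective []          (true  ∷ τ) ()
code-injective (false ∷ σ) []          ()
code-injective (true  ∷ σ) []          ()
code-injective (false ∷ σ) (false ∷ τ) eq =
  cong (false ∷_) (code-injective σ τ (*-cancelˡ-≡ _ _ 2 (suc-injective eq)))
code-injective (false ∷ σ) (true  ∷ τ) eq =
  ⊥-elim (even≢odd (code σ) (code τ) (suc-injective eq))
code-injective (true  ∷ σ) (false ∷ τ) eq =
  ⊥-elim (even≢odd (code τ) (code σ) (sym (suc-injective eq)))
code-injective (true  ∷ σ) (true  ∷ τ) eq =
  cong (true ∷_) (code-injective σ τ (*-cancelˡ-≡ _ _ 2 (suc-injective (suc-injective eq))))

triangle-mono : ∀ {m n} → m ≤ n → triangle m ≤ triangle n
triangle-mono z≤n       = z≤n
triangle-mono (s≤s m≤n) = +-mono-≤ (s≤s m≤n) (triangle-mono m≤n)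

pair-< : ∀ a b a′ b′ → a + b < a′ + b′ → pair a b < pair a′ b′
pair-< a b a′ b′ lt = begin-strict
  triangle (a + b) + b        ≤⟨ +-monoʳ-≤ (triangle (a + b)) (m≤n+m b a) ⟩
  triangle (a + b) + (a + b)  ≡⟨ +-comm (triangle (a + b)) (a + b) ⟩
  (a + b) + triangle (a + b)  <⟨ n<1+n _ ⟩
  triangle (suc (a + b))      ≤⟨ triangle-mono lt ⟩
  triangle (a′ + b′)          ≤⟨ m≤m+n _ b′ ⟩
  triangle (a′ + b′) + b′     ∎
  where open ≤-Reasoning

pair-injective : ∀ a b a′ b′ → pair a b ≡ pair a′ b′ → a ≡ a′ × b ≡ b′
pair-injective a b a′ b′ eq with <-cmp (a + b) (a′ + b′)
... | tri< lt _ _ = ⊥-elim (<⇒≢ (pair-< a b a′ b′ lt) eq)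
... | tri> _ _ gt = ⊥-elim (<⇒≢ (pair-< a′ b′ a b gt) (sym eq))
... | tri≈ _ s _  = a≡a′ , b≡b′
  where
  b≡b′ : b ≡ b′
  b≡b′ = +-cancelˡ-≡ (triangle (a + b)) b b′
           (trans eq (cong (λ t → triangle t + b′) (sym s)))
  a≡a′ : a ≡ a′
  a≡a′ = +-cancelʳ-≡ b a a′ (trans s (cong (a′ +_) (sym b≡b′)))

γ⇒Ext : ∀ T σ → (∀ ℓ → Form.γ Perfect-bin (code σ) ℓ ([] , T ∷ [])) → Ext σ T
γ⇒Ext T σ g ℓ
  with σ′ , eq , _ , e ← g ℓ
  with refl ← code-injective σ σ′ eq
  = e

Perfect-bin-correct : ∀ T → Problem.True (problem Perfect-bin) ([] , T ∷ []) ⇔ IsPerfect T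
Perfect-bin-correct T = mk⇔ to from
  where
  to : Problem.True (problem Perfect-bin) ([] , T ∷ []) → IsPerfect T
  to h σ σ∈T ext
    with c , p ← h (code σ) (λ ℓ → σ , refl , σ∈T , ext ℓ)
    with σ′ , τ₀ , τ₁ , eqσ , eqc , τ₀∈T , τ₁∈T , σ′⊑ , inc , _ ← p 0
    with refl ← code-injective σ σ′ eqσ
    = τ₀ , τ₁ , τ₀∈T , τ₁∈T , σ′⊑ , inc , (λ ℓ → proj₁ (both ℓ)) , (λ ℓ → proj₂ (both ℓ))
    where
    both : ∀ ℓ → ExtAt ℓ τ₀ T × ExtAt ℓ τ₁ T
    both ℓ
      with _ , ρ₀ , ρ₁ , _ , eqc′ , _ , _ , _ , _ , exts ← p ℓ
      with e₀ , e₁ ← pair-injective (code τ₀) (code τ₁) (code ρ₀) (code ρ₁) (trans (sym eqc) eqc′)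
      with refl ← code-injective τ₀ ρ₀ e₀
      with refl ← code-injective τ₁ ρ₁ e₁
      = exts

  from : IsPerfect T → Problem.True (problem Perfect-bin) ([] , T ∷ [])
  from perf a g
    with σ , refl , σ∈T , _ ← g 0
    with τ₀ , τ₁ , τ₀∈T , τ₁∈T , ⊑s , inc , ext₀ , ext₁ ← perf σ σ∈T (γ⇒Ext T σ g)
    = pair (code τ₀) (code τ₁) ,
      λ ℓ → σ , τ₀ , τ₁ , refl , refl , τ₀∈T , τ₁∈T , ⊑s , inc , ext₀ ℓ , ext₁ ℓ

module Submission where

-- The formula ∀a[∀b g(a,b) = 0 → ∃c ∀d h(a,c,d) = 0], with function parameters g and h, is strictly dicomplete:
-- bounded formulas are decidable relative to their parameters, and a and c, hence the witnesses, are kept.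
-- Perfect-bin reduces to it for the same reason.
--
-- Conversely, g and h give a tree T.  A node extending the stem 0ᵃ10 dies as soon as some g(a,b) ≠ 0 is seen, and a
-- node extending the limb 0ᵃ10ⁿ1, where n = ⟨c,j⟩, dies as soon as some h(a,c,d) ≠ 0 is seen; a stage is counted by
-- the code of the node, which is monotone under extension.  So the stem of a is extendible iff ∀b g(a,b) = 0, by
-- its trunk 0ᵃ10ⁿ, and then every node of the trunk splits iff ∀d h(a,c,d) = 0 for some c, since each c is
-- attached to infinitely many limbs.  An extendible node σ off the trunks always splits, into σ110 and σ111: neither
-- stems nor limbs contain 11, so no new stem begins inside 11, and a limb ends there only if σ is on a trunk.

open import Data.Bool using (Bool; true; false)
open import Data.Empty using (⊥-elim)
open import Data.Fin using (Fin; zero; suc)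
open import Data.Fin.Patterns
open import Data.List as List using (List; []; _∷_; length) renaming (_++_ to _⌢_)
open import Data.List.Properties using (length-++; ++-assoc)
open import Data.List.Relation.Binary.Prefix.Heterogeneous using ([]; _∷_)
open import Data.Nat using (ℕ; zero; suc; pred; _+_; _*_; _∸_; _^_; _≤_; _<_; z≤n; s≤s; _≟_; _<?_)
open import Data.Nat.Properties hiding (_≟_; _<?_)
open import Data.Nat.Solver using (module +-*-Solver)
open import Data.Product using (∃-syntax; _×_; _,_; proj₁; proj₂)
open import Data.Sum as Sum using (_⊎_; inj₁; inj₂; [_,_]′)
open import Data.Unit using (tt)
open import Data.Vec as Vec using (Vec; []; _∷_; lookup; tabulate)
open import Data.Vec.Functional using () renaming ([] to ε; _∷_ to _◂_)
open import Data.Vec.Properties using (lookup∘tabulate; tabulate∘lookup; length-toList; toList∘fromList)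
open import Function using (_∘_; const; id; case_of_)
open import Function.Bundles using (_⇔_; mk⇔; Equivalence)
open import Function.Construct.Composition using (_⇔-∘_)
open import Function.Construct.Identity using (⇔-id)
open import Function.Construct.Symmetry using (⇔-sym)
open import Relation.Binary.PropositionalEquality
open import Relation.Nullary using (¬_; Dec; yes; no; ¬?; decidable-stable)
open import Relation.Nullary.Decidable using (map′)

open import Defs

open Equivalence using (to; from)

private
  variable
    a b c d j k l m n ℓ : ℕ
    ρ σ τ τ₀ τ₁ : Str

-- Primitive recursive functions

litᵖ : ∀ {n} → ℕ → PrimRec n
litᵖ zero    = compᵖ zeroᵖ ε
litᵖ (suc k) = compᵖ sucᵖ (litᵖ k ◂ ε)

addᵖ mulᵖ pairᵖ monusᵖ eqᵖ andᵖ padᵖ : PrimRec 2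
pow2ᵖ triangleᵖ predᵖ notᵖ signᵖ : PrimRec 1
addᵖ      = recᵖ (projᵖ 0F) (compᵖ sucᵖ (projᵖ 1F ◂ ε))
mulᵖ      = recᵖ (litᵖ 0) (compᵖ addᵖ (projᵖ 2F ◂ projᵖ 1F ◂ ε))
pow2ᵖ     = recᵖ (litᵖ 1) (compᵖ mulᵖ (litᵖ 2 ◂ projᵖ 1F ◂ ε))
triangleᵖ = recᵖ (litᵖ 0) (compᵖ addᵖ (compᵖ sucᵖ (projᵖ 0F ◂ ε) ◂ projᵖ 1F ◂ ε))
pairᵖ     = compᵖ addᵖ (compᵖ triangleᵖ (addᵖ ◂ ε) ◂ projᵖ 1F ◂ ε)
predᵖ     = recᵖ (litᵖ 0) (projᵖ 0F)
notᵖ      = recᵖ (litᵖ 1) (litᵖ 0)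
signᵖ     = recᵖ (litᵖ 0) (litᵖ 1)
andᵖ      = recᵖ (projᵖ 0F) (litᵖ 1)
-- With the arguments swapped: the recursion is on the subtrahend.
monusᵖ    = recᵖ (projᵖ 0F) (compᵖ predᵖ (projᵖ 1F ◂ ε))
eqᵖ       = compᵖ signᵖ (compᵖ addᵖ (monusᵖ ◂ compᵖ monusᵖ (projᵖ 1F ◂ projᵖ 0F ◂ ε) ◂ ε) ◂ ε)
padᵖ      = recᵖ (projᵖ 0F) (compᵖ sucᵖ (compᵖ mulᵖ (litᵖ 2 ◂ projᵖ 1F ◂ ε) ◂ ε))

⟦litᵖ⟧ : ∀ {n} k (xs : Vec ℕ n) → ⟦ litᵖ k ⟧ᵖ xs ≡ k
⟦litᵖ⟧ zero    xs = refl
⟦litᵖ⟧ (suc k) xs = cong suc (⟦litᵖ⟧ k xs)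

⟦addᵖ⟧ : ∀ x y → ⟦ addᵖ ⟧ᵖ (x ∷ y ∷ []) ≡ x + y
⟦addᵖ⟧ zero    y = refl
⟦addᵖ⟧ (suc x) y = cong suc (⟦addᵖ⟧ x y)

⟦mulᵖ⟧ : ∀ x y → ⟦ mulᵖ ⟧ᵖ (x ∷ y ∷ []) ≡ x * y
⟦mulᵖ⟧ zero    y = refl
⟦mulᵖ⟧ (suc x) y = trans (⟦addᵖ⟧ y _) (cong (y +_) (⟦mulᵖ⟧ x y))

⟦pow2ᵖ⟧ : ∀ x → ⟦ pow2ᵖ ⟧ᵖ (x ∷ []) ≡ 2 ^ x
⟦pow2ᵖ⟧ zero    = refl
⟦pow2ᵖ⟧ (suc x) = trans (⟦mulᵖ⟧ 2 (⟦ pow2ᵖ ⟧ᵖ (x ∷ []))) (cong (2 *_) (⟦pow2ᵖ⟧ x))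

⟦triangleᵖ⟧ : ∀ x → ⟦ triangleᵖ ⟧ᵖ (x ∷ []) ≡ triangle x
⟦triangleᵖ⟧ zero    = refl
⟦triangleᵖ⟧ (suc x) = trans (⟦addᵖ⟧ (suc x) _) (cong (suc x +_) (⟦triangleᵖ⟧ x))

⟦pairᵖ⟧ : ∀ x y → ⟦ pairᵖ ⟧ᵖ (x ∷ y ∷ []) ≡ pair x y
⟦pairᵖ⟧ x y = trans (⟦addᵖ⟧ (⟦ triangleᵖ ⟧ᵖ (s ∷ [])) y)
  (cong (_+ y) (trans (⟦triangleᵖ⟧ s) (cong triangle (⟦addᵖ⟧ x y))))
  where s = ⟦ addᵖ ⟧ᵖ (x ∷ y ∷ [])

⟦predᵖ⟧ : ∀ x → ⟦ predᵖ ⟧ᵖ (x ∷ []) ≡ pred x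
⟦predᵖ⟧ zero    = refl
⟦predᵖ⟧ (suc x) = refl

⟦monusᵖ⟧ : ∀ x y → ⟦ monusᵖ ⟧ᵖ (y ∷ x ∷ []) ≡ x ∸ y
⟦monusᵖ⟧ x zero    = refl
⟦monusᵖ⟧ x (suc y) = begin
  ⟦ predᵖ ⟧ᵖ (⟦ monusᵖ ⟧ᵖ (y ∷ x ∷ []) ∷ []) ≡⟨ ⟦predᵖ⟧ (⟦ monusᵖ ⟧ᵖ (y ∷ x ∷ [])) ⟩
  pred (⟦ monusᵖ ⟧ᵖ (y ∷ x ∷ []))            ≡⟨ cong pred (⟦monusᵖ⟧ x y) ⟩
  pred (x ∸ y)                               ≡⟨ pred[m∸n]≡m∸[1+n] x y ⟩
  x ∸ suc y                                  ∎
  where open ≡-Reasoning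

⟦eqᵖ⟧ : ∀ x y → ⟦ eqᵖ ⟧ᵖ (x ∷ y ∷ []) ≡ ⟦ signᵖ ⟧ᵖ ((y ∸ x) + (x ∸ y) ∷ [])
⟦eqᵖ⟧ x y = cong (λ d → ⟦ signᵖ ⟧ᵖ (d ∷ []))
  (trans (⟦addᵖ⟧ (⟦ monusᵖ ⟧ᵖ (x ∷ y ∷ [])) (⟦ monusᵖ ⟧ᵖ (y ∷ x ∷ []))) (cong₂ _+_ (⟦monusᵖ⟧ y x) (⟦monusᵖ⟧ x y)))

⟦eqᵖ⟧-equal : ∀ x y → x ≡ y → ⟦ eqᵖ ⟧ᵖ (x ∷ y ∷ []) ≡ 0
⟦eqᵖ⟧-equal x x refl = trans (⟦eqᵖ⟧ x x) (cong (λ d → ⟦ signᵖ ⟧ᵖ (d + d ∷ [])) (n∸n≡0 x))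

⟦eqᵖ⟧-distinct : ∀ x y → ¬ x ≡ y → ⟦ eqᵖ ⟧ᵖ (x ∷ y ∷ []) ≡ 1
⟦eqᵖ⟧-distinct x y x≢y with (y ∸ x) + (x ∸ y) in eq | ⟦eqᵖ⟧ x y
... | suc d | e = e
... | zero  | _ = ⊥-elim (x≢y (≤-antisym (m∸n≡0⇒m≤n (m+n≡0⇒n≡0 (y ∸ x) eq)) (m∸n≡0⇒m≤n (m+n≡0⇒m≡0 (y ∸ x) eq))))

-- On codes of strings this prepends `k` digits `false`, each of which sends a code `x` to
-- `1 + 2 * x`.
pad : ℕ → ℕ → ℕ
pad zero    x = x
pad (suc k) x = 1 + 2 * pad k x

⟦padᵖ⟧ : ∀ k x → ⟦ padᵖ ⟧ᵖ (k ∷ x ∷ []) ≡ pad k x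
⟦padᵖ⟧ zero    x = refl
⟦padᵖ⟧ (suc k) x = cong suc (trans (⟦mulᵖ⟧ 2 (⟦ padᵖ ⟧ᵖ (k ∷ x ∷ []))) (cong (2 *_) (⟦padᵖ⟧ k x)))

-- Computable functions and decidable relations of oracles and numbers

Op : ℕ → ℕ → Set
Op m n = Vec (ℕ → ℕ) m → Vec ℕ n → ℕ

Rel : ℕ → ℕ → Set₁
Rel m n = Vec (ℕ → ℕ) m → Vec ℕ n → Set

record Computable {m n} (f : Op m n) : Set where
  constructor computed-by
  field
    program  : Code m n
    computes : ∀ αs xs → program [ αs ] xs ⇓ f αs xs
open Computable

-- The value 0 stands for truth, so that μ searches for a number satisfying a relation.
record Decidable {m n} (P : Rel m n) : Set where
  constructor decided-by
  field
    decider : Code m n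
    decides : ∀ αs xs → (P αs xs × decider [ αs ] xs ⇓ 0) ⊎ (¬ P αs xs × decider [ αs ] xs ⇓ 1)
open Decidable

decide : ∀ {P : Rel m n} → Decidable P → ∀ αs xs → Dec (P αs xs)
decide P? αs xs with decides P? αs xs
... | inj₁ (p , _)  = yes p
... | inj₂ (¬p , _) = no ¬p

args : (Fin k → Op m n) → Vec (ℕ → ℕ) m → Vec ℕ n → Vec ℕ k
args gs αs xs = tabulate λ i → gs i αs xs

module _ {gs : Fin k → Op m n} (gs! : ∀ i → Computable (gs i)) where

  ⇓compose : ∀ {c : Code m k} {αs xs y} → c [ αs ] args gs αs xs ⇓ y → comp c (program ∘ gs!) [ αs ] xs ⇓ y
  ⇓compose {αs = αs} {xs} = ⇓comp (args gs αs xs) λ i →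
    subst (program (gs! i) [ αs ] xs ⇓_) (sym (lookup∘tabulate (λ i → gs i αs xs) i)) (computes (gs! i) αs xs)

  compose : {f : Op m k} → Computable f → Computable (λ αs xs → f αs (args gs αs xs))
  compose f! = computed-by (comp (program f!) (program ∘ gs!)) λ αs xs → ⇓compose (computes f! αs _)

  infixl 9 _⟪_⟫
  _⟪_⟫ : {P : Rel m k} → Decidable P → Decidable (λ αs xs → P αs (args gs αs xs))
  _⟪_⟫ P? = decided-by (comp (decider P?) (program ∘ gs!)) λ αs xs →
    Sum.map (λ (p , e) → p , ⇓compose e) (λ (p , e) → p , ⇓compose e) (decides P? αs _)

primrec : (p : PrimRec n) → Computable {m} (λ _ → ⟦ p ⟧ᵖ)
primrec p = computed-by (prim p) λ _ _ → ⇓prim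

arg : (i : Fin n) → Computable {m} (λ _ xs → lookup xs i)
arg i = primrec (projᵖ i)

revalue : {f g : Op m n} → (∀ αs xs → f αs xs ≡ g αs xs) → Computable f → Computable g
revalue eq f! = computed-by (program f!) λ αs xs → subst (program f! [ αs ] xs ⇓_) (eq αs xs) (computes f! αs xs)

lit : (k : ℕ) → Computable {m} {n} (λ _ _ → k)
lit k = revalue (λ _ → ⟦litᵖ⟧ k) (primrec (litᵖ k))

module _ {f g : Op m n} (f! : Computable f) (g! : Computable g) where

  two : ∀ i → Computable ((f ◂ g ◂ ε) i)
  two 0F = f!
  two 1F = g!

one : {f : Op m n} → Computable f → ∀ i → Computable ((f ◂ ε) i)
one f! 0F = f!

unary : (p : PrimRec 1) {F : ℕ → ℕ} → (∀ x → ⟦ p ⟧ᵖ (x ∷ []) ≡ F x) →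
        {f : Op m n} → Computable f → Computable (λ αs xs → F (f αs xs))
unary p eq f! = revalue (λ _ _ → eq _) (compose (one f!) (primrec p))

binary : (p : PrimRec 2) {F : ℕ → ℕ → ℕ} → (∀ x y → ⟦ p ⟧ᵖ (x ∷ y ∷ []) ≡ F x y) →
         {f g : Op m n} → Computable f → Computable g → Computable (λ αs xs → F (f αs xs) (g αs xs))
binary p eq f! g! = revalue (λ _ _ → eq _ _) (compose (two f! g!) (primrec p))

module _ {f : Op m n} (f! : Computable f) where

  suc! : Computable (λ αs xs → suc (f αs xs))
  suc! = unary sucᵖ (λ _ → refl) f!

  pow2! : Computable (λ αs xs → 2 ^ f αs xs)
  pow2! = unary pow2ᵖ ⟦pow2ᵖ⟧ f!

  app! : (i : Fin m) → Computable (λ αs xs → lookup αs i (f αs xs))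
  app! i = compose (one f!) (computed-by {f = λ { αs (x ∷ []) → lookup αs i x }} (oracle i) λ { _ (_ ∷ []) → ⇓oracle })

  module _ {g : Op m n} (g! : Computable g) where

    infixl 6 _+!_
    infixl 7 _*!_
    _+!_ : Computable (λ αs xs → f αs xs + g αs xs)
    _+!_ = binary addᵖ ⟦addᵖ⟧ f! g!

    _*!_ : Computable (λ αs xs → f αs xs * g αs xs)
    _*!_ = binary mulᵖ ⟦mulᵖ⟧ f! g!

    pair! : Computable (λ αs xs → pair (f αs xs) (g αs xs))
    pair! = binary pairᵖ ⟦pairᵖ⟧ f! g!

    pad! : Computable (λ αs xs → pad (f αs xs) (g αs xs))
    pad! = binary padᵖ ⟦padᵖ⟧ f! g!

    infix 4 _≟!_
    _≟!_ : Decidable (λ αs xs → f αs xs ≡ g αs xs)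
    _≟!_ = decided-by (program difference) λ αs xs → case f αs xs ≟ g αs xs of λ
      { (yes f≡g) → inj₁ (f≡g , subst (program difference [ αs ] xs ⇓_) (⟦eqᵖ⟧-equal _ _ f≡g)
                                  (computes difference αs xs))
      ; (no f≢g)  → inj₂ (f≢g , subst (program difference [ αs ] xs ⇓_) (⟦eqᵖ⟧-distinct _ _ f≢g)
                                  (computes difference αs xs))
      }
      where difference = compose (two f! g!) (primrec eqᵖ)

via : {P Q : Rel m n} → Decidable P → (∀ αs xs → P αs xs ⇔ Q αs xs) → Decidable Q
via P? eq = decided-by (decider P?) λ αs xs →
  Sum.map (λ (p , e) → to (eq αs xs) p , e) (λ (¬p , e) → ¬p ∘ from (eq αs xs) , e) (decides P? αs xs)

module _ {P : Rel m n} (P? : Decidable P) where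

  indicator : Op m n
  indicator αs xs = [ const 0 , const 1 ]′ (decides P? αs xs)

  indicator! : Computable indicator
  indicator! = computed-by (decider P?) lemma
    where
    lemma : ∀ αs xs → decider P? [ αs ] xs ⇓ indicator αs xs
    lemma αs xs with decides P? αs xs
    ... | inj₁ (_ , e) = e
    ... | inj₂ (_ , e) = e

  indicator≡0 : ∀ αs xs → indicator αs xs ≡ 0 ⇔ P αs xs
  indicator≡0 αs xs with decides P? αs xs
  ... | inj₁ (p , _)  = mk⇔ (const p) (const refl)
  ... | inj₂ (¬p , _) = mk⇔ (λ ()) (⊥-elim ∘ ¬p)

  infix 8 ∁_
  ∁_ : Decidable (λ αs xs → ¬ P αs xs)
  ∁_ = decided-by (comp (prim notᵖ) (decider P? ◂ ε)) λ αs xs →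
    case decides P? αs xs of λ
      { (inj₁ (p , e))  → inj₂ ((λ ¬p → ¬p p) , ⇓comp (0 ∷ []) (λ { 0F → e }) ⇓prim)
      ; (inj₂ (¬p , e)) → inj₁ (¬p , ⇓comp (1 ∷ []) (λ { 0F → e }) ⇓prim)
      }

module _ {P Q : Rel m n} (P? : Decidable P) (Q? : Decidable Q) where

  infixr 3 _∩_
  _∩_ : Decidable (λ αs xs → P αs xs × Q αs xs)
  _∩_ = decided-by (comp (prim andᵖ) (decider P? ◂ decider Q? ◂ ε)) λ αs xs →
    case decides P? αs xs , decides Q? αs xs of λ
      { (inj₁ (p , e) , inj₁ (q , e′))  → inj₁ ((p , q) , ⇓comp (0 ∷ 0 ∷ []) (λ { 0F → e ; 1F → e′ }) ⇓prim)
      ; (inj₁ (p , e) , inj₂ (¬q , e′)) → inj₂ (¬q ∘ proj₂ , ⇓comp (0 ∷ 1 ∷ []) (λ { 0F → e ; 1F → e′ }) ⇓prim)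
      ; (inj₂ (¬p , e) , inj₁ (q , e′)) → inj₂ (¬p ∘ proj₁ , ⇓comp (1 ∷ 0 ∷ []) (λ { 0F → e ; 1F → e′ }) ⇓prim)
      ; (inj₂ (¬p , e) , inj₂ (_ , e′)) → inj₂ (¬p ∘ proj₁ , ⇓comp (1 ∷ 1 ∷ []) (λ { 0F → e ; 1F → e′ }) ⇓prim)
      }

module _ {P Q : Rel m n} (P? : Decidable P) (Q? : Decidable Q) where

  infixr 1 _⇒_
  _⇒_ : Decidable (λ αs xs → P αs xs → Q αs xs)
  _⇒_ = via (∁ (P? ∩ ∁ Q?)) λ αs xs → mk⇔
    (λ ¬p¬q p → case decide Q? αs xs of λ { (yes q) → q ; (no ¬q) → ⊥-elim (¬p¬q (p , ¬q)) })
    (λ { imp (p , ¬q) → ¬q (imp p) })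

  infixr 2 _∪_
  _∪_ : Decidable (λ αs xs → P αs xs ⊎ Q αs xs)
  _∪_ = via (∁ (∁ P? ∩ ∁ Q?)) λ αs xs → mk⇔
    (λ ¬¬p¬¬q → case decide P? αs xs , decide Q? αs xs of λ
       { (yes p , _)      → inj₁ p
       ; (no _ , yes q)   → inj₂ q
       ; (no ¬p , no ¬q) → ⊥-elim (¬¬p¬¬q (¬p , ¬q))
       })
    (λ { (inj₁ p) (¬p , _) → ¬p p ; (inj₂ q) (_ , ¬q) → ¬q q })

module _ {t : Op m n} {P : Rel m (suc n)} (t! : Computable t) (P? : Decidable P) where

  private
    step : Code m (2 + n)
    step = comp (prim andᵖ) (prim (projᵖ 1F) ◂
             comp (decider P?) (prim (projᵖ 0F) ◂ λ i → prim (projᵖ (suc (suc i)))) ◂ ε)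

    loop : Code m (1 + n)
    loop = rec (prim (litᵖ 0)) step

    ⇓step : ∀ {αs i z xs y} → decider P? [ αs ] i ∷ xs ⇓ y → step [ αs ] i ∷ z ∷ xs ⇓ ⟦ andᵖ ⟧ᵖ (z ∷ y ∷ [])
    ⇓step e = ⇓comp (_ ∷ _ ∷ []) (λ { 0F → ⇓prim ; 1F → ⇓comp (_ ∷ _) (λ { 0F → ⇓prim ; (suc i) → ⇓prim }) e }) ⇓prim

    loop-decides : ∀ αs xs k → ((∀ i → i < k → P αs (i ∷ xs)) × loop [ αs ] k ∷ xs ⇓ 0) ⊎
                               (¬ (∀ i → i < k → P αs (i ∷ xs)) × loop [ αs ] k ∷ xs ⇓ 1)
    loop-decides αs xs zero    = inj₁ ((λ _ ()) , ⇓rec0 ⇓prim)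
    loop-decides αs xs (suc k) with loop-decides αs xs k | decides P? αs (k ∷ xs)
    ... | inj₁ (h , e)  | inj₁ (p , e′)  = inj₁ ((λ i i<1+k → [ h i , (λ { refl → p }) ]′ (m<1+n⇒m<n∨m≡n i<1+k))
                                                  , ⇓recS e (⇓step e′))
    ... | inj₁ (h , e)  | inj₂ (¬p , e′) = inj₂ ((λ all → ¬p (all k ≤-refl)) , ⇓recS e (⇓step e′))
    ... | inj₂ (¬h , e) | inj₁ (p , e′)  = inj₂ ((λ all → ¬h λ i i<k → all i (m<n⇒m<1+n i<k)) , ⇓recS e (⇓step e′))
    ... | inj₂ (¬h , e) | inj₂ (¬p , e′) = inj₂ ((λ all → ¬p (all k ≤-refl)) , ⇓recS e (⇓step e′))

  ∀<! : Decidable (λ αs xs → ∀ i → i < t αs xs → P αs (i ∷ xs))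
  ∀<! = decided-by (comp loop (program t! ◂ λ i → prim (projᵖ i))) λ αs xs →
    Sum.map (λ (p , e) → p , ⇓comp (_ ∷ _) (λ { 0F → computes t! αs xs ; (suc i) → ⇓prim }) e)
            (λ (p , e) → p , ⇓comp (_ ∷ _) (λ { 0F → computes t! αs xs ; (suc i) → ⇓prim }) e)
            (loop-decides αs xs (t αs xs))

bounded-search : ∀ {P : ℕ → Set} → (∀ i → Dec (P i)) → ∀ k → (∀ i → i < k → ¬ P i) ⊎ ∃[ i ] i < k × P i
bounded-search P? zero = inj₁ λ _ ()
bounded-search P? (suc k) with bounded-search P? k | P? k
... | inj₂ (i , i<k , p) | _      = inj₂ (i , m<n⇒m<1+n i<k , p)
... | inj₁ _             | yes p  = inj₂ (k , ≤-refl , p)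
... | inj₁ none          | no ¬p  = inj₁ λ i i<1+k → [ none i , (λ { refl → ¬p }) ]′ (m<1+n⇒m<n∨m≡n i<1+k)

∃<! : {t : Op m n} {P : Rel m (suc n)} → Computable t → Decidable P →
      Decidable (λ αs xs → ∃[ i ] i < t αs xs × P αs (i ∷ xs))
∃<! t! P? = via (∁ (∀<! t! (∁ P?))) λ αs xs → mk⇔
  (λ ¬none → [ ⊥-elim ∘ ¬none , id ]′ (bounded-search (λ i → decide P? αs (i ∷ xs)) _))
  (λ (i , i<t , p) none → none i i<t p)

module _ {t : Op m n} {P : Rel m (suc n)} (t! : Computable t) (P? : Decidable P) where

  -- Not unique existence: the mark stands for computability. A quantifier whose solutions lie below
  -- a computable bound is a bounded one.
  ∃! : (∀ αs xs i → P αs (i ∷ xs) → i < t αs xs) → Decidable (λ αs xs → ∃[ i ] P αs (i ∷ xs))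
  ∃! bound = via (∃<! t! P?) λ αs xs → mk⇔ (λ (i , _ , p) → i , p) (λ (i , p) → i , bound αs xs i p , p)

  ∀! : (∀ αs xs i → ¬ i < t αs xs → P αs (i ∷ xs)) → Decidable (λ αs xs → ∀ i → P αs (i ∷ xs))
  ∀! above = via (∀<! t! P?) λ αs xs → mk⇔
    (λ all i → case i <? t αs xs of λ { (yes i<t) → all i i<t ; (no i≮t) → above αs xs i i≮t })
    (λ all i _ → all i)

module _ {P : Rel m n} (P? : Decidable P) (αs : Vec (ℕ → ℕ) m) (xs : Vec ℕ n) where

  -- Deciders return 0 for truth, whereas a tree has the value 1 at its members, so its
  -- characteristic function is the indicator of the complement.
  indicator∁≡1 : indicator (∁ P?) αs xs ≡ 1 ⇔ P αs xs
  indicator∁≡1 with decides P? αs xs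
  ... | inj₁ (p , _)  = mk⇔ (const p) (const refl)
  ... | inj₂ (¬p , _) = mk⇔ (λ ()) (⊥-elim ∘ ¬p)

  indicator-≡0∨≡1 : indicator P? αs xs ≡ 0 ⊎ indicator P? αs xs ≡ 1
  indicator-≡0∨≡1 with decides P? αs xs
  ... | inj₁ _ = inj₁ refl
  ... | inj₂ _ = inj₂ refl

-- Uniqueness makes `y` the least solution; below it the decider returns 1, a successor, as `⇓μ`
-- demands.
search : {P : Rel m (suc n)} (P? : Decidable P) → ∀ {αs xs y} →
         P αs (y ∷ xs) → (∀ z → P αs (z ∷ xs) → z ≡ y) → μ (decider P?) [ αs ] xs ⇓ y
search P? {αs} {xs} {y} p unique = ⇓μ
  ([ proj₂ , (λ (¬p , _) → ⊥-elim (¬p p)) ]′ (decides P? αs (y ∷ xs)))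
  λ z z<y → [ (λ (pz , _) → ⊥-elim (<⇒≢ z<y (unique z pz))) , (λ (_ , e) → 0 , e) ]′ (decides P? αs (z ∷ xs))

-- A function with a decidable graph is computed by searching for its value, which spares explicit
-- programs for unpairing and string length.
determined : {P : Rel m (suc n)} {f : Op m n} → Decidable P →
             (∀ αs xs → P αs (f αs xs ∷ xs)) → (∀ αs xs z → P αs (z ∷ xs) → z ≡ f αs xs) → Computable f
determined P? holds unique = computed-by (μ (decider P?)) λ αs xs → search P? (holds αs xs) (unique αs xs)

-- Decidability of bounded formulas

term! : (t : Term m n) → Computable ⟦ t ⟧ᵗ
term! (var i)    = arg i
term! (fun p ts) = compose (λ i → term! (ts i)) (primrec p)
term! (app j t)  = app! (term! t) j

bounded! : (φ : Bounded m n) → Decidable ⟦ φ ⟧ᵇ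
bounded! (s ≐ t)    = term! s ≟! term! t
bounded! (¬′ φ)     = ∁ bounded! φ
bounded! (φ ∧′ ψ)   = bounded! φ ∩ bounded! ψ
bounded! (φ ∨′ ψ)   = bounded! φ ∪ bounded! ψ
bounded! (φ ⇒′ ψ)   = bounded! φ ⇒ bounded! ψ
bounded! (∀< t · φ) = ∀<! (term! t) (bounded! φ)
bounded! (∃< t · φ) = ∃<! (term! t) (bounded! φ)

-- Unpairing

-- Cantor's enumeration step by step: down the diagonal from `(suc a, b)` to `(a, suc b)`, and from
-- its end `(0, b)` to the start `(suc b, 0)` of the next one.
unpair : ∀ n → ∃[ a ] ∃[ b ] pair a b ≡ n
unpair zero = 0 , 0 , refl
unpair (suc n) with unpair n
... | suc a , b , refl = a , suc b , (begin
  triangle (a + suc b) + suc b     ≡⟨ cong (λ s → triangle s + suc b) (+-suc a b) ⟩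
  triangle (suc (a + b)) + suc b   ≡⟨ +-suc _ b ⟩
  suc (pair (suc a) b)             ∎)
  where open ≡-Reasoning
... | zero , b , refl = suc b , 0 , (begin
  triangle (suc b + 0) + 0  ≡⟨ +-identityʳ _ ⟩
  triangle (suc b + 0)      ≡⟨ cong triangle (+-identityʳ (suc b)) ⟩
  suc (b + triangle b)      ≡⟨ cong suc (+-comm b _) ⟩
  suc (pair 0 b)            ∎)
  where open ≡-Reasoning

π₁ π₂ : ℕ → ℕ
π₁ n = proj₁ (unpair n)
π₂ n = proj₁ (proj₂ (unpair n))

pair-π : ∀ n → pair (π₁ n) (π₂ n) ≡ n
pair-π n = proj₂ (proj₂ (unpair n))

π₁-pair : ∀ a b → π₁ (pair a b) ≡ a
π₁-pair a b = proj₁ (pair-injective (π₁ (pair a b)) (π₂ (pair a b)) a b (pair-π (pair a b)))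

π₂-pair : ∀ a b → π₂ (pair a b) ≡ b
π₂-pair a b = proj₂ (pair-injective (π₁ (pair a b)) (π₂ (pair a b)) a b (pair-π (pair a b)))

n≤triangle : ∀ n → n ≤ triangle n
n≤triangle zero    = z≤n
n≤triangle (suc n) = m≤m+n (suc n) _

m≤pair : ∀ m n → m ≤ pair m n
m≤pair m n = ≤-trans (m≤m+n m n) (≤-trans (n≤triangle _) (m≤m+n _ n))

n≤pair : ∀ m n → n ≤ pair m n
n≤pair m n = m≤n+m n _

module _ {f : Op m n} (f! : Computable f) where

  π₁! : Computable (λ αs xs → π₁ (f αs xs))
  π₁! = compose (one f!) {f = λ _ xs → π₁ (lookup xs 0F)} (determined
    -- The search runs over the first component; the second is bounded by the pair itself.
    (∃<! (suc! (arg 1F)) (pair! (arg 1F) (arg 0F) ≟! arg 2F))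
    (λ { _ (n ∷ []) → π₂ n , s≤s (≤-trans (n≤pair (π₁ n) _) (≤-reflexive (pair-π n))) , pair-π n })
    (λ { _ (_ ∷ []) z (b , _ , refl) → sym (π₁-pair z b) }))

  π₂! : Computable (λ αs xs → π₂ (f αs xs))
  π₂! = compose (one f!) {f = λ _ xs → π₂ (lookup xs 0F)} (determined
    (∃<! (suc! (arg 1F)) (pair! (arg 0F) (arg 1F) ≟! arg 2F))
    (λ { _ (n ∷ []) → π₁ n , s≤s (≤-trans (m≤pair (π₁ n) _) (≤-reflexive (pair-π n))) , pair-π n })
    (λ { _ (_ ∷ []) z (a , _ , refl) → sym (π₂-pair a z) }))

-- Functionals

-- Substituting a program for each oracle removes the oracles, so that functionals send computable
-- tuples to computable tuples.
relativise : (Fin m → Code 0 1) → Code m n → Code 0 n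
relativise cs (prim p)    = prim p
relativise cs (oracle i)  = cs i
relativise cs (comp c ds) = comp (relativise cs c) λ i → relativise cs (ds i)
relativise cs (rec c d)   = rec (relativise cs c) (relativise cs d)
relativise cs (μ c)       = μ (relativise cs c)

⇓relativise : ∀ {cs : Fin m → Code 0 1} {αs} → (∀ i x → cs i [ [] ] x ∷ [] ⇓ lookup αs i x) →
              ∀ {c : Code m n} {xs y} → c [ αs ] xs ⇓ y → relativise cs c [ [] ] xs ⇓ y
⇓relativise cs⇓ ⇓prim           = ⇓prim
⇓relativise cs⇓ ⇓oracle         = cs⇓ _ _
⇓relativise cs⇓ (⇓comp zs es e) = ⇓comp zs (λ i → ⇓relativise cs⇓ (es i)) (⇓relativise cs⇓ e)
⇓relativise cs⇓ (⇓rec0 e)       = ⇓rec0 (⇓relativise cs⇓ e)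
⇓relativise cs⇓ (⇓recS e e′)    = ⇓recS (⇓relativise cs⇓ e) (⇓relativise cs⇓ e′)
⇓relativise cs⇓ (⇓μ e below)    = ⇓μ (⇓relativise cs⇓ e) λ z z<y →
  proj₁ (below z z<y) , ⇓relativise cs⇓ (proj₂ (below z z<y))

computable-image : ∀ {s t} (F : Functional s t) {x y} → F · x ↦ y → ComputableTuple x → ComputableTuple y
computable-image F {xs , αs} (_ , funs⇓) αs! j =
  -- The number components `xs` are fixed, so they enter the program as constants and only `n` is an
  -- input.
  comp (relativise (proj₁ ∘ αs!) (funs F j)) (prim (projᵖ 0F) ◂ λ i → prim (litᵖ (lookup xs i))) ,
  λ n → ⇓comp (n ∷ xs)
    (λ { 0F → ⇓prim ; (suc i) → subst (prim (litᵖ (lookup xs i)) [ [] ] n ∷ [] ⇓_) (⟦litᵖ⟧ _ (n ∷ [])) ⇓prim })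
    (⇓relativise (proj₂ ∘ αs!) (funs⇓ j n))

module _ {fs : Fin k → Op m n} {gs : Fin l → Op m (1 + n)}
         (fs! : ∀ i → Computable (fs i)) (gs! : ∀ j → Computable (gs j)) where

  functional : Functional ⟨ n , m ⟩ ⟨ k , l ⟩
  functional = record { nums = program ∘ fs! ; funs = program ∘ gs! }

  image : Tuple ⟨ n , m ⟩ → Tuple ⟨ k , l ⟩
  image (xs , αs) = args fs αs xs , tabulate λ j n → gs j αs (n ∷ xs)

  ↦image : ∀ x → functional · x ↦ image x
  ↦image (xs , αs) =
    (λ i → subst (program (fs! i) [ αs ] xs ⇓_) (sym (lookup∘tabulate (λ i → fs i αs xs) i)) (computes (fs! i) αs xs)) ,
    (λ j n → subst (program (gs! j) [ αs ] n ∷ xs ⇓_)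
      (sym (cong (λ β → β n) (lookup∘tabulate (λ j n → gs j αs (n ∷ xs)) j))) (computes (gs! j) αs (n ∷ xs)))

none : ∀ i → Computable {m} {n} (ε i)
none ()

-- A universal ∀→∃∀-formula

universal : ∀→∃∀-Formula
universal = record
  { shape = ⟨ 0 , 2 ⟩
  ; γ     = app 0F (fun pairᵖ (var 0F ◂ var 1F ◂ ε)) ≐ fun zeroᵖ ε
  ; θ     = app 1F (fun pairᵖ (var 0F ◂ fun pairᵖ (var 1F ◂ var 2F ◂ ε) ◂ ε)) ≐ fun zeroᵖ ε
  }

module _ (g h : ℕ → ℕ) where

  universal-γ : ∀ a b → g (pair a b) ≡ 0 ⇔ Form.γ (form universal) a b ([] , g ∷ h ∷ [])
  universal-γ a b = mk⇔ (trans (cong g (⟦pairᵖ⟧ a b))) (trans (cong g (sym (⟦pairᵖ⟧ a b))))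

  universal-θ : ∀ a c d → h (pair a (pair c d)) ≡ 0 ⇔ Form.θ (form universal) a c d ([] , g ∷ h ∷ [])
  universal-θ a c d = mk⇔ (trans (cong h eq)) (trans (cong h (sym eq)))
    where
    eq : ⟦ pairᵖ ⟧ᵖ (a ∷ ⟦ pairᵖ ⟧ᵖ (c ∷ d ∷ []) ∷ []) ≡ pair a (pair c d)
    eq = trans (⟦pairᵖ⟧ a (⟦ pairᵖ ⟧ᵖ (c ∷ d ∷ []))) (cong (pair a) (⟦pairᵖ⟧ c d))

-- Forms with decidable matrices reduce to the universal formula

-- Substituting these turns a relation of `a`, `b` and `xs` into one of `pair a b` and `xs`, the
-- form in which an oracle of `universal` holds it.
unpaired₂ : Fin (2 + n) → Op m (1 + n)
unpaired₂ = (λ _ xs → π₁ (lookup xs 0F)) ◂ (λ _ xs → π₂ (lookup xs 0F)) ◂ λ i _ xs → lookup xs (suc i)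

unpaired₂! : ∀ i → Computable {m} {1 + n} (unpaired₂ i)
unpaired₂! 0F            = π₁! (arg 0F)
unpaired₂! 1F            = π₂! (arg 0F)
unpaired₂! (suc (suc i)) = arg (suc i)

args-unpaired₂ : ∀ (αs : Vec (ℕ → ℕ) m) a b (xs : Vec ℕ n) → args unpaired₂ αs (pair a b ∷ xs) ≡ a ∷ b ∷ xs
args-unpaired₂ αs a b xs = cong₂ _∷_ (π₁-pair a b) (cong₂ _∷_ (π₂-pair a b) (tabulate∘lookup xs))

unpaired₃ : Fin (3 + n) → Op m (1 + n)
unpaired₃ = (λ _ xs → π₁ (lookup xs 0F)) ◂ (λ _ xs → π₁ (π₂ (lookup xs 0F))) ◂ (λ _ xs → π₂ (π₂ (lookup xs 0F))) ◂
            λ i _ xs → lookup xs (suc i)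

unpaired₃! : ∀ i → Computable {m} {1 + n} (unpaired₃ i)
unpaired₃! 0F                  = π₁! (arg 0F)
unpaired₃! 1F                  = π₁! (π₂! (arg 0F))
unpaired₃! 2F                  = π₂! (π₂! (arg 0F))
unpaired₃! (suc (suc (suc i))) = arg (suc i)

args-unpaired₃ : ∀ (αs : Vec (ℕ → ℕ) m) a b c (xs : Vec ℕ n) →
                 args unpaired₃ αs (pair a (pair b c) ∷ xs) ≡ a ∷ b ∷ c ∷ xs
args-unpaired₃ αs a b c xs = cong₂ _∷_ (π₁-pair a (pair b c)) (cong₂ _∷_
  (trans (cong π₁ eq) (π₁-pair b c)) (cong₂ _∷_ (trans (cong π₂ eq) (π₂-pair b c)) (tabulate∘lookup xs)))
  where eq = π₂-pair a (pair b c)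

untriple : ∀ n → ∃[ a ] ∃[ b ] ∃[ c ] pair a (pair b c) ≡ n
untriple n = π₁ n , π₁ (π₂ n) , π₂ (π₂ n) , trans (cong (pair (π₁ n)) (pair-π (π₂ n))) (pair-π n)

substitute : (P : Vec ℕ n → Set) → ∀ {xs ys} → xs ≡ ys → P xs ⇔ P ys
substitute P refl = ⇔-id _

module _ (φ : Form)
         {P : Rel (#funs (Form.shape φ)) (2 + #nums (Form.shape φ))}
         {Q : Rel (#funs (Form.shape φ)) (3 + #nums (Form.shape φ))}
         (P? : Decidable P) (Q? : Decidable Q)
         (P⇔γ : ∀ a b x → P (proj₂ x) (a ∷ b ∷ proj₁ x) ⇔ Form.γ φ a b x)
         (Q⇔θ : ∀ a c d x → Q (proj₂ x) (a ∷ c ∷ d ∷ proj₁ x) ⇔ Form.θ φ a c d x) where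

  private
    open Form φ

    γ? = unpaired₂! ⟪ P? ⟫
    θ? = unpaired₃! ⟪ Q? ⟫

    matrices! : ∀ i → Computable ((indicator γ? ◂ indicator θ? ◂ ε) i)
    matrices! 0F = indicator! γ?
    matrices! 1F = indicator! θ?

    η : Functional shape ⟨ 0 , 2 ⟩
    η = functional none matrices!

    y : Tuple shape → Tuple ⟨ 0 , 2 ⟩
    y = image none matrices!

    γ⇔ : ∀ a b x → γ a b x ⇔ Form.γ (form universal) a b (y x)
    γ⇔ a b x@(xs , αs) =
      universal-γ (λ n → indicator γ? αs (n ∷ xs)) (λ n → indicator θ? αs (n ∷ xs)) a b ⇔-∘
      (⇔-sym (indicator≡0 γ? αs (pair a b ∷ xs)) ⇔-∘
       (⇔-sym (substitute (P αs) (args-unpaired₂ αs a b xs)) ⇔-∘ ⇔-sym (P⇔γ a b x)))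

    θ⇔ : ∀ a c d x → θ a c d x ⇔ Form.θ (form universal) a c d (y x)
    θ⇔ a c d x@(xs , αs) =
      universal-θ (λ n → indicator γ? αs (n ∷ xs)) (λ n → indicator θ? αs (n ∷ xs)) a c d ⇔-∘
      (⇔-sym (indicator≡0 θ? αs (pair a (pair c d) ∷ xs)) ⇔-∘
       (⇔-sym (substitute (Q αs) (args-unpaired₃ αs a c d xs)) ⇔-∘ ⇔-sym (Q⇔θ a c d x)))

    -- In `α ▹ x` the witness comes before the instance, so copying a witness is reading oracle 0,
    -- or number 0 for the dual.
    first-oracle : ∀ {m n} → ∀ i → Computable {1 + m} {1 + n} (((λ αs xs → lookup αs 0F (lookup xs 0F)) ◂ ε) i)
    first-oracle 0F = app! (arg 0F) 0F

    first-number : ∀ {m n} → ∀ i → Computable {m} {1 + n} (((λ _ xs → lookup xs 0F) ◂ ε) i)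
    first-number 0F = arg 0F

  -- Stated for arbitrary decidable matrices, so as to cover both bounded formulas and the matrices
  -- of `Perfect-bin`.
  decidable⇒≤dm-universal : φ ≤dm form universal
  decidable⇒≤dm-universal = η ,
    (functional none first-oracle , functional none first-oracle , λ x (x! , _) →
      y x , ↦image none matrices! x , (computable-image η {x} {y x} (↦image none matrices! x) x! , tt) ,
      mk⇔ (λ φ! a g → case φ! a (λ b → from (γ⇔ a b x) (g b)) of λ (c , t) → c , λ d → to (θ⇔ a c d x) (t d))
          (λ ψ! a g → case ψ! a (λ b → to (γ⇔ a b x) (g b)) of λ (c , t) → c , λ d → from (θ⇔ a c d x) (t d)) ,
      (λ { α@([] , _ ∷ []) (partial , w) → α , ↦image none first-oracle (α ▹ x) , partial , λ a g →
             case w a (λ b → from (γ⇔ a b x) (g b)) of λ (c , e , t) → c , e , λ d → to (θ⇔ a c d x) (t d) }) ,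
      (λ { α@([] , _ ∷ []) (partial , w) → α , ↦image none first-oracle (α ▹ x) , partial , λ a g →
             case w a (λ b → to (γ⇔ a b x) (g b)) of λ (c , e , t) → c , e , λ d → from (θ⇔ a c d x) (t d) })) ,
    (functional first-number none , functional first-number none , λ x (x! , _) →
      y x , ↦image none matrices! x , (computable-image η {x} {y x} (↦image none matrices! x) x! , tt) ,
      mk⇔ (λ (a , g , t) → a , (λ b → to (γ⇔ a b x) (g b)) , λ c →
             case t c of λ (d , ¬θ) → d , ¬θ ∘ from (θ⇔ a c d x))
          (λ (a , g , t) → a , (λ b → from (γ⇔ a b x) (g b)) , λ c →
             case t c of λ (d , ¬θ) → d , ¬θ ∘ to (θ⇔ a c d x)) ,
      (λ { α@(a ∷ [] , []) (g , t) → α , ↦image first-number none (α ▹ x) , (λ b → to (γ⇔ a b x) (g b)) , λ c →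
             case t c of λ (d , ¬θ) → d , ¬θ ∘ from (θ⇔ a c d x) }) ,
      (λ { α@(a ∷ [] , []) (g , t) → α , ↦image first-number none (α ▹ x) , (λ b → from (γ⇔ a b x) (g b)) , λ c →
             case t c of λ (d , ¬θ) → d , ¬θ ∘ to (θ⇔ a c d x) }))

universal-strictly-dicomplete : StrictlyDicomplete universal
universal-strictly-dicomplete χ = decidable⇒≤dm-universal (form χ)
  (bounded! (∀→∃∀-Formula.γ χ)) (bounded! (∀→∃∀-Formula.θ χ)) (λ _ _ _ → ⇔-id _) (λ _ _ _ _ → ⇔-id _)

-- R (i ∷ a ∷ c ∷ xs) says that i witnesses the value c at a; the index ⟨i,⟨a,c⟩⟩ then enumerates the pair ⟨a,c⟩.
module _ {R : Rel m (3 + n)} (R? : Decidable R) where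

  private
    R′? = unpaired₃! ⟪ R? ⟫

  enumeration : Op m (1 + n)
  -- The first factor is 1 where `R` holds and 0 elsewhere, and the value 0 enumerates nothing.
  enumeration αs xs = indicator (∁ R′?) αs xs * suc (π₂ (lookup xs 0F))

  enumeration! : Computable enumeration
  enumeration! = indicator! (∁ R′?) *! suc! (π₂! (arg 0F))

  module _ (αs : Vec (ℕ → ℕ) m) (xs : Vec ℕ n) where

    private
      β : ℕ → ℕ
      β i = enumeration αs (i ∷ xs)

      β-cases : ∀ i a c → (R αs (i ∷ a ∷ c ∷ xs) × β (pair i (pair a c)) ≡ suc (pair a c)) ⊎
                          (¬ R αs (i ∷ a ∷ c ∷ xs) × β (pair i (pair a c)) ≡ 0)
      β-cases i a c with decides (∁ R′?) αs (pair i (pair a c) ∷ xs)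
      ... | inj₁ (¬r , _)  = inj₂ (¬r ∘ from (substitute (R αs) (args-unpaired₃ αs i a c xs)) , refl)
      ... | inj₂ (¬¬r , _) with decide R? αs (i ∷ a ∷ c ∷ xs)
      ...   | yes r = inj₁ (r , trans (+-identityʳ _) (cong suc (π₂-pair i (pair a c))))
      ...   | no ¬r = ⊥-elim (¬¬r (¬r ∘ to (substitute (R αs) (args-unpaired₃ αs i a c xs))))

    enumerates : ∀ {a c} → β ∋ a ↦ c ⇔ (∃[ i ] R αs (i ∷ a ∷ c ∷ xs))
    enumerates {a} {c} = mk⇔ forth back
      where
      forth : β ∋ a ↦ c → ∃[ i ] R αs (i ∷ a ∷ c ∷ xs)
      forth (n , e) with i , a′ , c′ , refl ← untriple n
                    with β-cases i a′ c′
      ... | inj₂ (_ , e′) = case trans (sym e) e′ of λ ()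
      ... | inj₁ (r , e′) with refl , refl ← pair-injective a c a′ c′ (suc-injective (trans (sym e) e′)) = i , r

      back : ∃[ i ] R αs (i ∷ a ∷ c ∷ xs) → β ∋ a ↦ c
      back (i , r) = pair i (pair a c) , [ proj₂ , (λ (¬r , _) → ⊥-elim (¬r r)) ]′ (β-cases i a c)

    enumeration-partial : (∀ {i j a c c′} → R αs (i ∷ a ∷ c ∷ xs) → R αs (j ∷ a ∷ c′ ∷ xs) → c ≡ c′) →
                          IsPartialFunction β
    enumeration-partial functional = range , λ a c c′ e e′ →
      functional {a = a} (proj₂ (to enumerates e)) (proj₂ (to enumerates e′))
      where
      range : ∀ n → β n ≡ 0 ⊎ ∃[ a ] ∃[ c ] β n ≡ suc (pair a c)
      range n with i , a , c , refl ← untriple n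
              = [ (λ (_ , e) → inj₂ (a , c , e)) , (λ (_ , e) → inj₁ e) ]′ (β-cases i a c)

-- Strings

-- The successor in bijective base 2, least significant digit first; iterating it from the empty
-- string inverts `code`.
increment : Str → Str
increment []          = false ∷ []
increment (false ∷ σ) = true ∷ σ
increment (true ∷ σ)  = false ∷ increment σ

code-increment : ∀ σ → code (increment σ) ≡ suc (code σ)
code-increment []          = refl
code-increment (false ∷ σ) = refl
code-increment (true ∷ σ)  = cong suc (trans (cong (2 *_) (code-increment σ)) (*-suc 2 (code σ)))

decode : ℕ → Str
decode zero    = []
decode (suc n) = increment (decode n)

code-decode : ∀ n → code (decode n) ≡ n
code-decode zero    = refl
code-decode (suc n) = trans (code-increment (decode n)) (cong suc (code-decode n))

decode-code : ∀ σ → decode (code σ) ≡ σ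
decode-code σ = code-injective _ _ (code-decode (code σ))

-- The digits of `τ` are shifted by `length σ` places. This gives both the computability of
-- concatenation and the monotonicity of `code` under extension.
code-++ : ∀ σ τ → code (σ ⌢ τ) ≡ code σ + 2 ^ length σ * code τ
code-++ []          τ = sym (+-identityʳ _)
code-++ (false ∷ σ) τ = trans (cong (λ c → 1 + 2 * c) (code-++ σ τ))
  (solve 3 (λ s p t → con 1 :+ con 2 :* (s :+ p :* t) := con 1 :+ con 2 :* s :+ con 2 :* p :* t) refl
    (code σ) (2 ^ length σ) (code τ))
  where open +-*-Solver
code-++ (true ∷ σ)  τ = trans (cong (λ c → 2 + 2 * c) (code-++ σ τ))
  (solve 3 (λ s p t → con 2 :+ con 2 :* (s :+ p :* t) := con 2 :+ con 2 :* s :+ con 2 :* p :* t) refl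
    (code σ) (2 ^ length σ) (code τ))
  where open +-*-Solver

zeros : ℕ → Str → Str
zeros zero    σ = σ
zeros (suc k) σ = false ∷ zeros k σ

code-zeros : ∀ k σ → code (zeros k σ) ≡ pad k (code σ)
code-zeros zero    σ = refl
code-zeros (suc k) σ = cong (λ c → 1 + 2 * c) (code-zeros k σ)

-- Together with `<2*2^length`: the length of `σ` is the binary logarithm of `suc (code σ)`, rounded
-- down.
2^length≤ : ∀ σ → 2 ^ length σ ≤ suc (code σ)
2^length≤ []          = ≤-refl
2^length≤ (false ∷ σ) = ≤-trans (*-monoʳ-≤ 2 (2^length≤ σ)) (≤-reflexive (*-suc 2 (code σ)))
2^length≤ (true ∷ σ)  = m≤n⇒m≤1+n (≤-trans (*-monoʳ-≤ 2 (2^length≤ σ)) (≤-reflexive (*-suc 2 (code σ))))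

<2*2^length : ∀ σ → suc (code σ) < 2 * 2 ^ length σ
<2*2^length []          = ≤-refl
<2*2^length (false ∷ σ) = ≤-trans (s≤s (≤-trans (n≤1+n _) (≤-reflexive (sym (cong suc (*-suc 2 (code σ)))))))
  (≤-trans (≤-reflexive (sym (*-suc 2 (suc (code σ))))) (*-monoʳ-≤ 2 (<2*2^length σ)))
<2*2^length (true ∷ σ)  = ≤-trans
  (≤-reflexive (solve 1 (λ c → con 4 :+ con 2 :* c := con 2 :* (con 2 :+ c)) refl (code σ)))
  (*-monoʳ-≤ 2 (<2*2^length σ))
  where open +-*-Solver

length≤code : ∀ σ → length σ ≤ code σ
length≤code []          = z≤n
length≤code (false ∷ σ) = s≤s (≤-trans (length≤code σ) (m≤n*m (code σ) 2))
length≤code (true ∷ σ)  = s≤s (m≤n⇒m≤1+n (≤-trans (length≤code σ) (m≤n*m (code σ) 2)))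

2^-bounds⇒≤ : ∀ {x} k l → 2 ^ k ≤ x → x < 2 * 2 ^ l → k ≤ l
2^-bounds⇒≤ k l lower upper = ≮⇒≥ λ l<k →
  <-irrefl refl (<-≤-trans upper (≤-trans (^-monoʳ-≤ 2 l<k) lower))

-- The prefix order

⊑-refl : σ ⊑ σ
⊑-refl {[]}    = []
⊑-refl {x ∷ σ} = refl ∷ ⊑-refl

⊑-trans : ρ ⊑ σ → σ ⊑ τ → ρ ⊑ τ
⊑-trans []         _          = []
⊑-trans (refl ∷ p) (refl ∷ q) = refl ∷ ⊑-trans p q

⊑-++ : ∀ σ {τ} → σ ⊑ σ ⌢ τ
⊑-++ []      = []
⊑-++ (x ∷ σ) = refl ∷ ⊑-++ σ

++-cancelˡ-⊑ : ∀ ρ → ρ ⌢ σ ⊑ ρ ⌢ τ → σ ⊑ τ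
++-cancelˡ-⊑ []      p       = p
++-cancelˡ-⊑ (x ∷ ρ) (_ ∷ p) = ++-cancelˡ-⊑ ρ p

⊑⇒++ : σ ⊑ τ → ∃[ ρ ] τ ≡ σ ⌢ ρ
⊑⇒++ {τ = τ} []   = τ , refl
⊑⇒++ (refl ∷ p) with ρ , refl ← ⊑⇒++ p = ρ , refl

code-mono : σ ⊑ τ → code σ ≤ code τ
code-mono {σ} p with ρ , refl ← ⊑⇒++ p = ≤-trans (m≤m+n _ _) (≤-reflexive (sym (code-++ σ ρ)))

-- Computable operations and decidable relations on strings

StrOp : ℕ → ℕ → Set
StrOp m n = Vec (ℕ → ℕ) m → Vec ℕ n → Str

record ComputableStr {m n} (S : StrOp m n) : Set where
  constructor coded
  field
    code! : Computable (λ αs xs → code (S αs xs))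
open ComputableStr

weaken! : {f : Op m n} → Computable f → Computable {m} {1 + n} (λ αs xs → f αs (Vec.tail xs))
weaken! {f = f} f! = revalue (λ { αs (x ∷ xs) → cong (f αs) (tabulate∘lookup xs) }) (compose (λ i → arg (suc i)) f!)

decode! : {f : Op m n} → Computable f → ComputableStr (λ αs xs → decode (f αs xs))
decode! f! = coded (revalue (λ _ _ → sym (code-decode _)) f!)

module _ {S : StrOp m n} (S! : ComputableStr S) where

  length! : Computable (λ αs xs → length (S αs xs))
  length! = revalue (λ αs xs → cong length (decode-code (S αs xs)))
    (compose (one (code! S!)) {f = λ _ xs → length (decode (lookup xs 0F))} (determined
      -- The length `l` of the string with code `s` is determined by `suc s ≡ 2 ^ l + r` with
      -- `r < 2 ^ l`: it is the position of the leading binary digit of `suc s`.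
      (∃<! (pow2! (arg 0F)) (suc! (arg 2F) ≟! pow2! (arg 1F) +! arg 0F))
      (λ { _ (s ∷ []) → exists s }) (λ { _ (s ∷ []) l (r , r<2^l , eq) → unique s l r r<2^l eq })))
    where
    lower : ∀ s → 2 ^ length (decode s) ≤ suc s
    lower s = subst (λ c → 2 ^ length (decode s) ≤ suc c) (code-decode s) (2^length≤ (decode s))

    upper : ∀ s → suc s < 2 * 2 ^ length (decode s)
    upper s = subst (λ c → suc c < 2 * 2 ^ length (decode s)) (code-decode s) (<2*2^length (decode s))

    exists : ∀ s → ∃[ r ] r < 2 ^ length (decode s) × suc s ≡ 2 ^ length (decode s) + r
    exists s = suc s ∸ p ,
               +-cancelˡ-< p _ _ (subst₂ _<_ (sym (m+[n∸m]≡n (lower s))) (cong (p +_) (+-identityʳ p)) (upper s)) ,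
               sym (m+[n∸m]≡n (lower s))
      where p = 2 ^ length (decode s)

    unique : ∀ s l r → r < 2 ^ l → suc s ≡ 2 ^ l + r → l ≡ length (decode s)
    unique s l r r<2^l eq = ≤-antisym
      (2^-bounds⇒≤ l _ (≤-trans (m≤m+n _ r) (≤-reflexive (sym eq))) (upper s))
      (2^-bounds⇒≤ _ l (lower s) (<-≤-trans (≤-<-trans (≤-reflexive eq) (+-monoʳ-< (2 ^ l) r<2^l))
        (≤-reflexive (cong (2 ^ l +_) (sym (+-identityʳ (2 ^ l)))))))

  zeros! : {f : Op m n} → Computable f → ComputableStr (λ αs xs → zeros (f αs xs) (S αs xs))
  zeros! {f} f! = coded (revalue (λ αs xs → sym (code-zeros (f αs xs) (S αs xs))) (pad! f! (code! S!)))

  zero∷! : ComputableStr (λ αs xs → false ∷ S αs xs)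
  zero∷! = coded (lit 1 +! lit 2 *! code! S!)

  one∷! : ComputableStr (λ αs xs → true ∷ S αs xs)
  one∷! = coded (lit 2 +! lit 2 *! code! S!)

  module _ {R : StrOp m n} (R! : ComputableStr R) where

    infixr 5 _++!_
    _++!_ : ComputableStr (λ αs xs → S αs xs ⌢ R αs xs)
    _++!_ = coded (revalue (λ αs xs → sym (code-++ (S αs xs) (R αs xs))) (code! S! +! pow2! length! *! code! R!))

module _ {S : StrOp m n} (S! : ComputableStr S) where

  weakenStr! : ComputableStr {m} {1 + n} (λ αs xs → S αs (Vec.tail xs))
  weakenStr! = coded (weaken! (code! S!))

  infix 4 _⊑?_
  -- The remainder of a string after a prefix has at most the code of the whole string, so a bounded
  -- search finds it.
  _⊑?_ : {R : StrOp m n} → ComputableStr R → Decidable (λ αs xs → S αs xs ⊑ R αs xs)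
  _⊑?_ {R} R! = via
    (∃<! (suc! (code! R!)) (weaken! (code! R!) ≟! code! (weakenStr! ++! decode! (arg 0F))))
    λ αs xs → mk⇔
      (λ (u , _ , eq) → subst (S αs xs ⊑_) (sym (code-injective _ _ eq)) (⊑-++ (S αs xs)))
      (λ p → case ⊑⇒++ p of λ (ρ , eq) → code ρ ,
        s≤s (≤-trans (bound (S αs xs) ρ) (≤-reflexive (cong code (sym eq)))) ,
        cong code (trans eq (cong (S αs xs ⌢_) (sym (decode-code ρ)))))
    where
    bound : ∀ σ ρ → code ρ ≤ code (σ ⌢ ρ)
    bound σ ρ = ≤-trans (≤-trans (m≤n*m (code ρ) (2 ^ length σ) {{m^n≢0 2 (length σ)}}) (m≤n+m _ (code σ)))
                        (≤-reflexive (sym (code-++ σ ρ)))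

  infix 4 _≟ˢ_
  _≟ˢ_ : {R : StrOp m n} → ComputableStr R → Decidable (λ αs xs → S αs xs ≡ R αs xs)
  _≟ˢ_ R! = via (code! S! ≟! code! R!) λ _ _ → mk⇔ (code-injective _ _) (cong code)

  -- Strings of length `ℓ` have codes below `2 * 2 ^ ℓ`, which turns the quantifier over vectors
  -- into a bounded one over numbers.
  ExtAt? : {f : Op m n} → Computable f → (i : Fin m) → Decidable (λ αs xs → ExtAt (f αs xs) (S αs xs) (lookup αs i))
  ExtAt? {f} f! i = via
    (∃<! (lit 2 *! pow2! f!)
         ((length! (decode! (arg 0F)) ≟! weaken! f!) ∩
          (app! (code! (weakenStr! ++! decode! (arg 0F))) i ≟! lit 1)))
    λ αs xs → mk⇔ (λ (u , _ , eq , u∈T) → extAt {σ = S αs xs} {lookup αs i} (decode u) eq u∈T) (λ (τ , τ∈T) →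
      code (Vec.toList τ) ,
      <-≤-trans (≤-trans (n≤1+n _) (<2*2^length (Vec.toList τ)))
        (≤-reflexive (cong (λ ℓ → 2 * 2 ^ ℓ) (length-toList τ))) ,
      trans (cong length (decode-code (Vec.toList τ))) (length-toList τ) ,
      subst (λ ρ → S αs xs ⌢ ρ ∈ lookup αs i) (sym (decode-code (Vec.toList τ))) τ∈T)
    where
    extAt : ∀ {ℓ σ T} τ → length τ ≡ ℓ → σ ⌢ τ ∈ T → ExtAt ℓ σ T
    extAt {σ = σ} {T} τ refl τ∈T = Vec.fromList τ , subst (λ ρ → σ ⌢ ρ ∈ T) (sym (toList∘fromList τ)) τ∈T

-- Decidability of the matrices of `Perfect-bin`

Splits : ℕ → Str → Str → Str → (ℕ → ℕ) → Set
Splits ℓ σ τ₀ τ₁ T =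
  τ₀ ∈ T × τ₁ ∈ T × (σ ⊑ τ₀ × σ ⊑ τ₁) × τ₀ ⊥ τ₁ × (ExtAt ℓ τ₀ T × ExtAt ℓ τ₁ T)

extendible? : Decidable {1} {2} (λ αs xs →
  decode (lookup xs 0F) ∈ lookup αs 0F × ExtAt (lookup xs 1F) (decode (lookup xs 0F)) (lookup αs 0F))
extendible? = (app! (code! (decode! (arg 0F))) 0F ≟! lit 1) ∩ ExtAt? (decode! (arg 0F)) (arg 1F) 0F

splits? : Decidable {1} {3} (λ αs xs →
  Splits (lookup xs 2F) (decode (lookup xs 0F)) (decode (π₁ (lookup xs 1F))) (decode (π₂ (lookup xs 1F)))
    (lookup αs 0F))
splits? = (app! (code! τ₀!) 0F ≟! lit 1) ∩ (app! (code! τ₁!) 0F ≟! lit 1) ∩ (σ! ⊑? τ₀! ∩ σ! ⊑? τ₁!) ∩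
          (∁ (τ₀! ⊑? τ₁!) ∩ ∁ (τ₁! ⊑? τ₀!)) ∩ (ExtAt? τ₀! (arg 2F) 0F ∩ ExtAt? τ₁! (arg 2F) 0F)
  where
  σ!  = decode! (arg 0F)
  τ₀! = decode! (π₁! (arg 1F))
  τ₁! = decode! (π₂! (arg 1F))

module Perfect = Form Perfect-bin

-- Every number codes exactly one string, so the string asserted by `γ` can only be `decode a`.
extendible⇔γ : ∀ a ℓ T → (decode a ∈ T × ExtAt ℓ (decode a) T) ⇔ Perfect.γ a ℓ ([] , T ∷ [])
extendible⇔γ a ℓ T = mk⇔
  (λ e → decode a , sym (code-decode a) , e)
  (λ { (σ , refl , e) → subst (λ σ → σ ∈ T × ExtAt ℓ σ T) (sym (decode-code σ)) e })

splits⇔θ : ∀ a c ℓ T → Splits ℓ (decode a) (decode (π₁ c)) (decode (π₂ c)) T ⇔ Perfect.θ a c ℓ ([] , T ∷ [])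
splits⇔θ a c ℓ T = mk⇔
  (λ s → decode a , decode (π₁ c) , decode (π₂ c) , sym (code-decode a) ,
     trans (sym (pair-π c)) (sym (cong₂ pair (code-decode (π₁ c)) (code-decode (π₂ c)))) , s)
  (λ { (σ , τ₀ , τ₁ , refl , refl , s) →
     let p = π₁-pair (code τ₀) (code τ₁)
         q = π₂-pair (code τ₀) (code τ₁)
     in subst (λ σ → Splits ℓ σ _ _ T) (sym (decode-code σ))
          (subst₂ (λ τ₀ τ₁ → Splits ℓ σ τ₀ τ₁ T)
            (sym (trans (cong decode p) (decode-code τ₀))) (sym (trans (cong decode q) (decode-code τ₁))) s) })

Perfect-bin≤dm-universal : Perfect-bin ≤dm form universal
Perfect-bin≤dm-universal = decidable⇒≤dm-universal Perfect-bin extendible? splits?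
  (λ { a ℓ ([] , T ∷ []) → extendible⇔γ a ℓ T }) (λ { a c ℓ ([] , T ∷ []) → splits⇔θ a c ℓ T })

-- The tree

-- The 0 after the 1 separates it from the closing 1 of `limb a 0`, so that no limb contains 11.
stem : ℕ → Str → Str
stem a ρ = zeros a (true ∷ false ∷ ρ)

trunk : ℕ → ℕ → Str
trunk a n = stem a (zeros n [])

limb : ℕ → ℕ → Str → Str
limb a n ρ = stem a (zeros n (true ∷ ρ))

zeros-++ : ∀ k σ τ → zeros k σ ⌢ τ ≡ zeros k (σ ⌢ τ)
zeros-++ zero    σ τ = refl
zeros-++ (suc k) σ τ = cong (false ∷_) (zeros-++ k σ τ)

zeros-+ : ∀ k l σ → zeros k (zeros l σ) ≡ zeros (k + l) σ
zeros-+ zero    l σ = refl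
zeros-+ (suc k) l σ = cong (false ∷_) (zeros-+ k l σ)

k≤code-zeros : ∀ k σ → k ≤ code (zeros k σ)
k≤code-zeros zero    σ = z≤n
k≤code-zeros (suc k) σ = s≤s (≤-trans (k≤code-zeros k σ) (m≤n*m _ 2))

code≤code-∷ : ∀ x σ → code σ ≤ code (x ∷ σ)
code≤code-∷ false σ = m≤n⇒m≤1+n (m≤n*m _ 2)
code≤code-∷ true  σ = m≤n⇒m≤1+n (code≤code-∷ false σ)

code≤code-zeros : ∀ k σ → code σ ≤ code (zeros k σ)
code≤code-zeros zero    σ = ≤-refl
code≤code-zeros (suc k) σ = ≤-trans (code≤code-zeros k σ) (code≤code-∷ false (zeros k σ))

zeros-mono-⊑ : ∀ k → σ ⊑ τ → zeros k σ ⊑ zeros k τ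
zeros-mono-⊑ zero    p = p
zeros-mono-⊑ (suc k) p = refl ∷ zeros-mono-⊑ k p

stem-mono-⊑ : ∀ a → σ ⊑ τ → stem a σ ⊑ stem a τ
stem-mono-⊑ a p = zeros-mono-⊑ a (refl ∷ refl ∷ p)

zeros-≤-⊑ : k ≤ l → zeros k [] ⊑ zeros l σ
zeros-≤-⊑ z≤n     = []
zeros-≤-⊑ (s≤s p) = refl ∷ zeros-≤-⊑ p

-- The first 1 fixes the number of 0s before it. All uniqueness statements about stems and limbs
-- rest on this.
zeros-one-⊑ : ∀ k l → zeros k (true ∷ σ) ⊑ zeros l (true ∷ τ) → k ≡ l × σ ⊑ τ
zeros-one-⊑ zero    zero    (_ ∷ p) = refl , p
zeros-one-⊑ zero    (suc l) (() ∷ _)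
zeros-one-⊑ (suc k) zero    (() ∷ _)
zeros-one-⊑ (suc k) (suc l) (_ ∷ p) = let e , q = zeros-one-⊑ k l p in cong suc e , q

zeros-one-⋢-zeros : ∀ k l → ¬ zeros k (true ∷ σ) ⊑ zeros l []
zeros-one-⋢-zeros zero    (suc l) (() ∷ _)
zeros-one-⋢-zeros (suc k) (suc l) (_ ∷ p)  = zeros-one-⋢-zeros k l p

zeros-⋢-zeros-one : ∀ k → ¬ zeros (suc k) [] ⊑ zeros k (true ∷ σ)
zeros-⋢-zeros-one zero    (() ∷ _)
zeros-⋢-zeros-one (suc k) (_ ∷ p)  = zeros-⋢-zeros-one k p

zeros-one-⊑⇒≡ : ∀ k → zeros k (true ∷ ρ) ⊑ σ → ∃[ τ ] σ ≡ zeros k (true ∷ τ) × ρ ⊑ τ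
zeros-one-⊑⇒≡ zero    (refl ∷ p) = _ , refl , p
zeros-one-⊑⇒≡ (suc k) (refl ∷ p) = let τ , e , q = zeros-one-⊑⇒≡ k p in τ , cong (false ∷_) e , q

zeros-view : ∀ σ → (∃[ k ] σ ≡ zeros k []) ⊎ (∃[ k ] ∃[ τ ] σ ≡ zeros k (true ∷ τ))
zeros-view []          = inj₁ (0 , refl)
zeros-view (true ∷ σ)  = inj₂ (0 , σ , refl)
zeros-view (false ∷ σ) with zeros-view σ
... | inj₁ (k , e)     = inj₁ (suc k , cong (false ∷_) e)
... | inj₂ (k , τ , e) = inj₂ (suc k , τ , cong (false ∷_) e)

stem-⊑-stem : ∀ a b → stem a σ ⊑ stem b τ → a ≡ b × σ ⊑ τ
stem-⊑-stem a b p with refl , (_ ∷ q) ← zeros-one-⊑ a b p = refl , q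

stem-⊑⇒≡ : ∀ a → stem a ρ ⊑ σ → ∃[ τ ] σ ≡ stem a τ × ρ ⊑ τ
stem-⊑⇒≡ a p with _ , e , (refl ∷ q) ← zeros-one-⊑⇒≡ a p = _ , e , q

stem-unique : ∀ a b → stem a [] ⊑ σ → stem b [] ⊑ σ → a ≡ b
stem-unique a b p q with _ , refl , _ ← stem-⊑⇒≡ b q = proj₁ (stem-⊑-stem a b p)

limb-⊑-limb : ∀ a b k l → limb a k σ ⊑ limb b l τ → a ≡ b × k ≡ l
limb-⊑-limb a b k l p with refl , q ← stem-⊑-stem a b p = refl , proj₁ (zeros-one-⊑ k l q)

limb-unique : ∀ a b k l → limb a k [] ⊑ σ → limb b l [] ⊑ σ → a ≡ b × k ≡ l
limb-unique a b k l p q with _ , refl , r ← stem-⊑⇒≡ b q with _ , refl , _ ← zeros-one-⊑⇒≡ l r = limb-⊑-limb a b k l p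

limb-⋢-trunk : ∀ a b k l → ¬ limb a k [] ⊑ trunk b l
limb-⋢-trunk a b k l p = zeros-one-⋢-zeros k l (proj₂ (stem-⊑-stem a b p))

trunk-injective : ∀ a b k l → trunk a k ≡ trunk b l → a ≡ b × k ≡ l
trunk-injective a b k l e with refl , p ← stem-⊑-stem a b (subst (trunk a k ⊑_) e ⊑-refl)
                          with _ , q ← stem-⊑-stem a a (subst (_⊑ trunk a k) e ⊑-refl)
                          = refl , ≤-antisym (bound k l p) (bound l k q)
  where
  bound : ∀ k l → zeros k [] ⊑ zeros l [] → k ≤ l
  bound zero    l       _       = z≤n
  bound (suc k) (suc l) (_ ∷ p) = s≤s (bound k l p)

Trunk : Str → Set
Trunk σ = ∃[ a ] ∃[ n ] σ ≡ trunk a n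

-- A stem ending inside the appended 11 would match its final 0 with a 1, and one ending beyond
-- would contain 11.
stem-⊑-11 : ∀ a σ → stem a [] ⊑ σ ⌢ true ∷ true ∷ τ → stem a [] ⊑ σ
stem-⊑-11 zero    []          (_ ∷ () ∷ _)
stem-⊑-11 (suc a) []          (() ∷ _)
stem-⊑-11 zero    (x ∷ [])    (_ ∷ () ∷ _)
stem-⊑-11 zero    (x ∷ y ∷ σ) (p ∷ q ∷ _) = p ∷ q ∷ []
stem-⊑-11 (suc a) (x ∷ σ)     (p ∷ ps)    = p ∷ stem-⊑-11 a σ ps

-- By `stem-⊑-11` the stem lies within `σ`. Being off the trunk, `σ` also contains the closing 1 of
-- some limb, and a string extends only one limb. On the trunk, the appended 1 would itself close a
-- limb.
limb-⊑-11 : ∀ a n σ → ¬ Trunk σ → limb a n [] ⊑ σ ⌢ true ∷ true ∷ τ → limb a n [] ⊑ σ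
limb-⊑-11 {τ} a n σ ¬trunk p
  with ρ , refl , _ ← stem-⊑⇒≡ a (stem-⊑-11 a σ (⊑-trans (stem-mono-⊑ a []) p))
  with zeros-view ρ
... | inj₁ (k , refl)      = ⊥-elim (¬trunk (a , k , refl))
... | inj₂ (k , ρ′ , refl) = subst (λ k → limb a n [] ⊑ limb a k ρ′)
  (proj₂ (limb-⊑-limb a a n k (subst (limb a n [] ⊑_) eq p))) (stem-mono-⊑ a (zeros-mono-⊑ n (refl ∷ [])))
  where
  eq : limb a k ρ′ ⌢ true ∷ true ∷ τ ≡ limb a k (ρ′ ⌢ true ∷ true ∷ τ)
  eq = trans (zeros-++ a _ _) (cong (λ ρ → zeros a (true ∷ false ∷ ρ)) (zeros-++ k _ _))

module _ (g h : ℕ → ℕ) where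

  Member : Str → Set
  Member σ = (∀ a → stem a [] ⊑ σ → ∀ b → b < code σ → g (pair a b) ≡ 0) ×
             (∀ a c j → limb a (pair c j) [] ⊑ σ → ∀ d → d < code σ → h (pair a (pair c d)) ≡ 0)

  Member-⊑ : σ ⊑ τ → Member τ → Member σ
  Member-⊑ p (s , t) = (λ a q b b< → s a (⊑-trans q p) b (<-≤-trans b< (code-mono p))) ,
                       (λ a c j q d d< → t a c j (⊑-trans q p) d (<-≤-trans d< (code-mono p)))

  -- A trunk extends no limb and only one stem, so only the checks of `g` at this `a` apply.
  trunk-Member : (∀ b → g (pair a b) ≡ 0) → ∀ n → Member (trunk a n)
  trunk-Member {a} Γ n = (λ a′ p b _ → subst (λ a → g (pair a b) ≡ 0) (sym (proj₁ (stem-⊑-stem a′ a p))) (Γ b)) ,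
                         (λ a′ c j p → ⊥-elim (limb-⋢-trunk a′ a (pair c j) n p))

  -- The string extends a single limb, so `h` is checked for this `a` and `c` alone, and only up to
  -- the stage of the string.
  limb-Member : ∀ c j → (∀ b → g (pair a b) ≡ 0) → (∀ d → d < code (limb a (pair c j) ρ) → h (pair a (pair c d)) ≡ 0) →
                Member (limb a (pair c j) ρ)
  limb-Member {a} {ρ} c j Γ Θ =
    (λ a′ p b _ → subst (λ a → g (pair a b) ≡ 0) (sym (proj₁ (stem-⊑-stem a′ a p))) (Γ b)) , limbs
    where
    limbs : ∀ a′ c′ j′ → limb a′ (pair c′ j′) [] ⊑ limb a (pair c j) ρ →
            ∀ d → d < code (limb a (pair c j) ρ) → h (pair a′ (pair c′ d)) ≡ 0
    limbs a′ c′ j′ p d d< with refl , e ← limb-⊑-limb a′ a (pair c′ j′) (pair c j) p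
                          with refl , _ ← pair-injective c′ j′ c j e = Θ d d<

-- Decidability of membership in the tree

const! : (σ : Str) → ComputableStr {m} {n} (λ _ _ → σ)
const! σ = coded (lit (code σ))

module _ {f : Op m n} (f! : Computable f) where

  stem! : {S : StrOp m n} → ComputableStr S → ComputableStr (λ αs xs → stem (f αs xs) (S αs xs))
  stem! S! = zeros! (one∷! (zero∷! S!)) f!

  module _ {k : Op m n} (k! : Computable k) where

    trunk! : ComputableStr (λ αs xs → trunk (f αs xs) (k αs xs))
    trunk! = stem! (zeros! (const! []) k!)

    limb! : ComputableStr (λ αs xs → limb (f αs xs) (k αs xs) [])
    limb! = stem! (zeros! (one∷! (const! [])) k!)

stem-bound : ∀ a → stem a [] ⊑ σ → a ≤ code σ
stem-bound a p = ≤-trans (k≤code-zeros a _) (code-mono p)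

trunk-bound : ∀ a n → σ ≡ trunk a n → a ≤ code σ × n ≤ code σ
trunk-bound a n refl = k≤code-zeros a _ , (begin
  n                                ≤⟨ k≤code-zeros n [] ⟩
  code (zeros n [])                ≤⟨ code≤code-∷ false (zeros n []) ⟩
  code (false ∷ zeros n [])        ≤⟨ code≤code-∷ true (false ∷ zeros n []) ⟩
  code (true ∷ false ∷ zeros n []) ≤⟨ code≤code-zeros a _ ⟩
  code (trunk a n)                 ∎)
  where open ≤-Reasoning

limb-bound : ∀ a n → limb a n [] ⊑ σ → a ≤ code σ × n ≤ code σ
limb-bound a n p = let q , r = trunk-bound a n refl in
  ≤-trans q (code-mono p′) , ≤-trans r (code-mono p′)
  where p′ = ⊑-trans (stem-mono-⊑ a (zeros-≤-⊑ ≤-refl)) p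

abstract
  -- Once `a`, `c` or `j` exceeds the code of the string, the string cannot extend the stem or limb
  -- and the implication is vacuous; so bounded quantifiers suffice.
  Member? : Decidable {2} {1} (λ αs xs → Member (lookup αs 0F) (lookup αs 1F) (decode (lookup xs 0F)))
  Member? =
    ∀! (suc! (code! (decode! (arg 0F))))
      ((stem! (arg 0F) (const! []) ⊑? decode! (arg 1F)) ⇒
       ∀<! (code! (decode! (arg 1F))) (app! (pair! (arg 1F) (arg 0F)) 0F ≟! lit 0))
      (λ _ xs a a> p → ⊥-elim (a> (s≤s (stem-bound a p)))) ∩
    ∀! (suc! (code! (decode! (arg 0F))))
      (∀! (suc! (code! (decode! (arg 1F))))
        (∀! (suc! (code! (decode! (arg 2F))))
          ((limb! (arg 2F) (pair! (arg 1F) (arg 0F)) ⊑? decode! (arg 3F)) ⇒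
           ∀<! (code! (decode! (arg 3F))) (app! (pair! (arg 3F) (pair! (arg 2F) (arg 0F))) 1F ≟! lit 0))
          (λ { _ (c ∷ a ∷ s ∷ []) j j> p → ⊥-elim (j> (s≤s (≤-trans (n≤pair c j) (proj₂ (limb-bound a _ p))))) }))
        (λ { _ (a ∷ s ∷ []) c c> j p → ⊥-elim (c> (s≤s (≤-trans (m≤pair c j) (proj₂ (limb-bound a _ p))))) }))
      (λ { _ (s ∷ []) a a> c j p → ⊥-elim (a> (s≤s (proj₁ (limb-bound a _ p)))) })

-- Extendible and splitting nodes

toList-replicate-false : ∀ ℓ → Vec.toList (Vec.replicate ℓ false) ≡ zeros ℓ []
toList-replicate-false zero    = refl
toList-replicate-false (suc ℓ) = cong (false ∷_) (toList-replicate-false ℓ)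

_⌢110 _⌢111 : Str → Str
σ ⌢110 = σ ⌢ true ∷ true ∷ false ∷ []
σ ⌢111 = σ ⌢ true ∷ true ∷ true ∷ []

module Tree (g h T : ℕ → ℕ) (∈T⇔Member : ∀ σ → σ ∈ T ⇔ Member g h σ) where

  Γ : ℕ → Set
  Γ a = ∀ b → g (pair a b) ≡ 0

  -- A node surviving `suc ℓ` further levels has passed the check at stage `ℓ`. This is the source
  -- of `suc b` and `suc d` below.
  <code-extension : ∀ σ (v : Vec Bool (suc ℓ)) → ℓ < code (σ ⌢ Vec.toList v)
  <code-extension {ℓ} σ v = begin-strict
    ℓ                                <⟨ n<1+n ℓ ⟩
    suc ℓ                            ≡⟨ length-toList v ⟨
    length (Vec.toList v)            ≤⟨ m≤n+m _ (length σ) ⟩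
    length σ + length (Vec.toList v) ≡⟨ length-++ σ ⟨
    length (σ ⌢ Vec.toList v)        ≤⟨ length≤code (σ ⌢ Vec.toList v) ⟩
    code (σ ⌢ Vec.toList v)          ∎
    where open ≤-Reasoning

  ExtAt-stem : ∀ a b → stem a [] ⊑ σ → ExtAt (suc b) σ T → g (pair a b) ≡ 0
  ExtAt-stem {σ} a b p (v , e) =
    proj₁ (to (∈T⇔Member (σ ⌢ Vec.toList v)) e) a (⊑-trans p (⊑-++ σ)) b (<code-extension σ v)

  ExtAt-limb : ∀ a c d j → limb a (pair c j) [] ⊑ σ → ExtAt (suc d) σ T → h (pair a (pair c d)) ≡ 0
  ExtAt-limb {σ} a c d j p (v , e) =
    proj₂ (to (∈T⇔Member (σ ⌢ Vec.toList v)) e) a c j (⊑-trans p (⊑-++ σ)) d (<code-extension σ v)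

  ∈T-⊑ : σ ⊑ τ → τ ∈ T → σ ∈ T
  ∈T-⊑ {σ} {τ} p τ∈T = from (∈T⇔Member σ) (Member-⊑ g h p (to (∈T⇔Member τ) τ∈T))

  ExtAt⇒∈ : ∀ σ → ExtAt ℓ σ T → σ ∈ T
  ExtAt⇒∈ σ (v , e) = ∈T-⊑ (⊑-++ σ) e

  -- Extendibility is always shown by padding with 0s: a padded trunk stays on the trunk, and a
  -- padded limb meets no other limb.
  ExtAt-zeros : ∀ σ ℓ → Member g h (σ ⌢ zeros ℓ []) → ExtAt ℓ σ T
  ExtAt-zeros σ ℓ s = Vec.replicate ℓ false ,
    from (∈T⇔Member (σ ⌢ _)) (subst (λ τ → Member g h (σ ⌢ τ)) (sym (toList-replicate-false ℓ)) s)

  splits : ∀ {τ₀ τ₁} → σ ⊑ τ₀ → σ ⊑ τ₁ → τ₀ ⊥ τ₁ → ExtAt ℓ τ₀ T → ExtAt ℓ τ₁ T → Splits ℓ σ τ₀ τ₁ T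
  splits {τ₀ = τ₀} {τ₁} p q inc e e′ = ExtAt⇒∈ τ₀ e , ExtAt⇒∈ τ₁ e′ , (p , q) , inc , (e , e′)

  -- Extendibility of `σ` passes every check on its own stem and limb, at all stages; since
  -- appending 11 adds neither a stem nor a limb, all strings above σ11 are in the tree.
  splits-off-trunk : ¬ Trunk σ → Ext σ T → ∀ ℓ → Splits ℓ σ (σ ⌢110) (σ ⌢111) T
  splits-off-trunk {σ} ¬trunk ext ℓ = splits (⊑-++ σ) (⊑-++ σ)
    ((λ p → case ++-cancelˡ-⊑ σ p of λ { (_ ∷ _ ∷ () ∷ _) }) , (λ p → case ++-cancelˡ-⊑ σ p of λ { (_ ∷ _ ∷ () ∷ _) }))
    (ExtAt-zeros (σ ⌢110) ℓ (member false)) (ExtAt-zeros (σ ⌢111) ℓ (member true))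
    where
    member : ∀ x → Member g h ((σ ⌢ true ∷ true ∷ x ∷ []) ⌢ zeros ℓ [])
    member x = subst (Member g h) (sym (++-assoc σ _ _))
      ((λ a p b _ → ExtAt-stem a b (stem-⊑-11 a σ p) (ext (suc b))) ,
       (λ a c j p d _ → ExtAt-limb a c d j (limb-⊑-11 a (pair c j) σ ¬trunk p) (ext (suc d))))

  trunk-++ : ∀ a k ℓ → trunk a k ⌢ zeros ℓ [] ≡ trunk a (k + ℓ)
  trunk-++ a k ℓ = trans (zeros-++ a _ _) (cong (λ ρ → stem a ρ) (trans (zeros-++ k _ _) (zeros-+ k ℓ [])))

  limb-++ : ∀ a k τ → limb a k [] ⌢ τ ≡ limb a k τ
  limb-++ a k τ = trans (zeros-++ a _ _) (cong (λ ρ → stem a ρ) (zeros-++ k (true ∷ []) τ))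

  trunk-Ext : ∀ {a} → Γ a → ∀ n → Ext (trunk a n) T
  trunk-Ext {a} Γa n ℓ =
    ExtAt-zeros (trunk a n) ℓ (subst (Member g h) (sym (trunk-++ a n ℓ)) (trunk-Member g h Γa (n + ℓ)))

  -- One branch stays on the trunk, the other leaves it along a limb of `c`. The hypothesis on `h`
  -- is bounded so that a failure to split at level `ℓ` yields a concrete `d`.
  splits-trunk : ∀ {a} c n ℓ → Γ a → (∀ d → d < code (limb a (pair c n) (zeros ℓ [])) → h (pair a (pair c d)) ≡ 0) →
                 Splits ℓ (trunk a n) (trunk a (suc (pair c n))) (limb a (pair c n) []) T
  splits-trunk {a} c n ℓ Γa Θ< = splits
    -- Taking `n` itself as the second component gives `n ≤ pair c n`, so the limb leaves the trunk
    -- at or above the node.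
    (stem-mono-⊑ a (zeros-≤-⊑ (m≤n⇒m≤1+n (n≤pair c n)))) (stem-mono-⊑ a (zeros-≤-⊑ (n≤pair c n)))
    ((λ p → zeros-⋢-zeros-one (pair c n) (proj₂ (stem-⊑-stem a a p))) ,
     (λ p → limb-⋢-trunk a a (pair c n) (suc (pair c n)) p))
    (trunk-Ext {a} Γa (suc (pair c n)) ℓ)
    (ExtAt-zeros (limb a (pair c n) []) ℓ
      (subst (Member g h) (sym (limb-++ a (pair c n) _)) (limb-Member g h c n Γa Θ<)))

-- c is read off the limb that τ₀ extends or, only if τ₀ is on the trunk, off the one that τ₁ extends, so it is unique.
Reads : ℕ → Str → Str → ℕ → Set
Reads a τ₀ τ₁ c = (∃[ j ] limb a (pair c j) [] ⊑ τ₀) ⊎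
                  (∃[ n ] τ₀ ≡ trunk a n) × (∃[ j ] limb a (pair c j) [] ⊑ τ₁)

pair-unique : ∀ c c′ j j′ → limb a (pair c j) [] ⊑ σ → limb a (pair c′ j′) [] ⊑ σ → c ≡ c′
pair-unique {a} c c′ j j′ p q =
  proj₁ (pair-injective c j c′ j′ (proj₂ (limb-unique a a (pair c j) (pair c′ j′) p q)))

Reads-functional : ∀ c c′ → Reads a τ₀ τ₁ c → Reads a τ₀ τ₁ c′ → c ≡ c′
Reads-functional c c′ (inj₁ (j , p))     (inj₁ (j′ , q))     = pair-unique c c′ j j′ p q
Reads-functional c c′ (inj₂ (_ , j , p)) (inj₂ (_ , j′ , q)) = pair-unique c c′ j j′ p q
Reads-functional {a} c c′ (inj₁ (j , p)) (inj₂ ((n , refl) , _)) = ⊥-elim (limb-⋢-trunk a a (pair c j) n p)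
Reads-functional {a} c c′ (inj₂ ((n , refl) , _)) (inj₁ (j , p)) = ⊥-elim (limb-⋢-trunk a a (pair c′ j) n p)

trunk-or-limb : stem a [] ⊑ σ → (∃[ n ] σ ≡ trunk a n) ⊎ (∃[ c ] ∃[ j ] limb a (pair c j) [] ⊑ σ)
trunk-or-limb {a} p with ρ , refl , _ ← stem-⊑⇒≡ a p with zeros-view ρ
... | inj₁ (n , refl)     = inj₁ (n , refl)
... | inj₂ (n , τ , refl) = inj₂ (π₁ n , π₂ n ,
  subst (λ k → limb a k [] ⊑ limb a n τ) (sym (pair-π n)) (stem-mono-⊑ a (zeros-mono-⊑ n (refl ∷ []))))

trunks-comparable : ∀ k l → ¬ trunk a k ⊥ trunk a l
trunks-comparable {a} k l (⋢ , ⋣) with ≤-total k l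
... | inj₁ k≤l = ⋢ (stem-mono-⊑ a (zeros-≤-⊑ k≤l))
... | inj₂ l≤k = ⋣ (stem-mono-⊑ a (zeros-≤-⊑ l≤k))

-- The trunk of `a` is a chain, so of two incomparable strings above the stem at least one has left
-- it along a limb.
Reads-exists : stem a [] ⊑ τ₀ → stem a [] ⊑ τ₁ → τ₀ ⊥ τ₁ → ∃[ c ] Reads a τ₀ τ₁ c
Reads-exists p q inc with trunk-or-limb p | trunk-or-limb q
... | inj₂ (c , j , r)  | _                = c , inj₁ (j , r)
... | inj₁ (k , e)      | inj₂ (c , j , r) = c , inj₂ ((k , e) , j , r)
... | inj₁ (k , refl)   | inj₁ (l , refl)  = ⊥-elim (trunks-comparable k l inc)

-- Decidable relations behind the witness translations

Reads? : {f : Op m n} {S R : StrOp m n} {v : Op m n} → Computable f → ComputableStr S → ComputableStr R → Computable v →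
         Decidable (λ αs xs → Reads (f αs xs) (S αs xs) (R αs xs) (v αs xs))
Reads? {f = f} {S} {R} {v} f! S! R! v! =
  limb-below? S! ∪
  (∃! (suc! (code! S!)) (weakenStr! S! ≟ˢ trunk! (weaken! f!) (arg 0F))
     (λ αs xs n e → s≤s (proj₂ (trunk-bound (f αs xs) n e))) ∩
   limb-below? R!)
  where
  limb-below? : {S : StrOp _ _} → ComputableStr S →
                Decidable (λ αs xs → ∃[ j ] limb (f αs xs) (pair (v αs xs) j) [] ⊑ S αs xs)
  limb-below? {S} S! = ∃! (suc! (code! S!))
    (limb! (weaken! f!) (pair! (weaken! v!) (arg 0F)) ⊑? weakenStr! S!)
    (λ αs xs j p → s≤s (≤-trans (n≤pair (v αs xs) j) (proj₂ (limb-bound (f αs xs) _ p))))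

Trunk? : {S : StrOp m n} → ComputableStr S → Decidable (λ αs xs → Trunk (S αs xs))
Trunk? {S = S} S! = ∃! (suc! (code! S!))
  (∃! (suc! (weaken! (code! S!)))
    (weakenStr! (weakenStr! S!) ≟ˢ trunk! (arg 1F) (arg 0F))
    (λ { αs (a ∷ xs) n e → s≤s (proj₂ (trunk-bound a n e)) }))
  (λ { αs xs a (n , e) → s≤s (proj₁ (trunk-bound a n e)) })

abstract
  trunk? : ∀ σ → Dec (Trunk σ)
  trunk? σ = decide (Trunk? {0} {0} (const! σ)) [] []

fork : Str → ℕ
fork σ = pair (code (σ ⌢110)) (code (σ ⌢111))

branch : ℕ → ℕ → ℕ → ℕ
branch a n c = pair (code (trunk a (suc (pair c n)))) (code (limb a (pair c n) []))

-- The oracles are a witness for the universal formula and g, h; the numbers are an index, a string and a value.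
SplitBy : Rel 3 3
SplitBy (α ∷ _) (i ∷ s ∷ v ∷ []) =
  (∃[ a ] ∃[ n ] ∃[ c ] decode s ≡ trunk a n × α i ≡ suc (pair a c) × v ≡ branch a n c) ⊎
  (¬ Trunk (decode s) × v ≡ fork (decode s))

abstract
  SplitBy? : Decidable SplitBy
  SplitBy? = via
    (∃! (suc! (code! (decode! (arg 1F))))
       (∃! (suc! (code! (decode! (arg 2F))))
          (∃! (app! (arg 2F) 0F)
            ((decode! (arg 4F) ≟ˢ trunk! (arg 2F) (arg 1F)) ∩
             (app! (arg 3F) 0F ≟! suc! (pair! (arg 2F) (arg 0F))) ∩
             (arg 5F ≟! pair! (code! (trunk! (arg 2F) (suc! (pair! (arg 0F) (arg 1F)))))
                              (code! (limb! (arg 2F) (pair! (arg 0F) (arg 1F))))))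
            -- An enumerated value `suc (pair a c)` exceeds `c`, so `α i` bounds the search.
            (λ { _ (_ ∷ a ∷ _) c (_ , e , _) → ≤-trans (s≤s (n≤pair a c)) (≤-reflexive (sym e)) }))
          (λ { _ (a ∷ _) n (_ , e , _) → s≤s (proj₂ (trunk-bound a n e)) }))
       (λ _ _ a (n , _ , e , _) → s≤s (proj₁ (trunk-bound a n e))) ∪
     (∁ Trunk? (decode! (arg 1F))) ∩
     (arg 2F ≟! pair! (code! (decode! (arg 1F) ++! const! (true ∷ true ∷ false ∷ [])))
                       (code! (decode! (arg 1F) ++! const! (true ∷ true ∷ true ∷ [])))))
    (λ { (α ∷ _) (i ∷ s ∷ v ∷ []) → ⇔-id _ })

-- The oracles are a witness for Perfect-bin and g, h; the numbers are an index, a and a value.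
ReadFrom : Rel 3 3
ReadFrom (α ∷ _) (i ∷ a ∷ c ∷ []) =
  ∃[ t₀ ] ∃[ t₁ ] α i ≡ suc (pair (code (stem a [])) (pair t₀ t₁)) × Reads a (decode t₀) (decode t₁) c

abstract
  ReadFrom? : Decidable ReadFrom
  ReadFrom? = via
    (∃! (app! (arg 0F) 0F)
       (∃! (app! (arg 1F) 0F)
         ((app! (arg 2F) 0F ≟! suc! (pair! (code! (stem! (arg 3F) (const! []))) (pair! (arg 1F) (arg 0F)))) ∩
          Reads? (arg 3F) (decode! (arg 1F)) (decode! (arg 0F)) (arg 4F))
         (λ { _ (t₀ ∷ i ∷ a ∷ _) t₁ (e , _) →
           ≤-trans (s≤s (≤-trans (n≤pair t₀ t₁) (n≤pair (code (stem a [])) _))) (≤-reflexive (sym e)) }))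
       (λ { _ (i ∷ a ∷ _) t₀ (t₁ , e , _) →
         ≤-trans (s≤s (≤-trans (m≤pair t₀ t₁) (n≤pair (code (stem a [])) _))) (≤-reflexive (sym e)) }))
    (λ { (α ∷ _) (i ∷ a ∷ c ∷ []) → ⇔-id _ })

-- Single-valuedness of the translated witnesses

-- A string on a trunk determines `a` and `n`, and then `α` determines `c`, whatever the index; off
-- the trunks the value depends on the string alone.
SplitBy-functional : ∀ α g h → IsPartialFunction α → ∀ {i j s v w} →
                     SplitBy (α ∷ g ∷ h ∷ []) (i ∷ s ∷ v ∷ []) → SplitBy (α ∷ g ∷ h ∷ []) (j ∷ s ∷ w ∷ []) → v ≡ w
SplitBy-functional α g h (_ , single) {i} {j} (inj₁ (a , n , c , e , p , refl)) (inj₁ (a′ , n′ , c′ , e′ , p′ , refl))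
  with refl , refl ← trunk-injective a a′ n n′ (trans (sym e) e′)
  with refl ← single a c c′ (i , p) (j , p′) = refl
SplitBy-functional α g h _ (inj₁ (a , n , _ , e , _)) (inj₂ (¬trunk , _)) = ⊥-elim (¬trunk (a , n , e))
SplitBy-functional α g h _ (inj₂ (¬trunk , _)) (inj₁ (a , n , _ , e , _)) = ⊥-elim (¬trunk (a , n , e))
SplitBy-functional α g h _ (inj₂ (_ , refl)) (inj₂ (_ , refl)) = refl

ReadFrom-functional : ∀ α g h → IsPartialFunction α → ∀ {i j a c c′} →
                      ReadFrom (α ∷ g ∷ h ∷ []) (i ∷ a ∷ c ∷ []) → ReadFrom (α ∷ g ∷ h ∷ []) (j ∷ a ∷ c′ ∷ []) → c ≡ c′
ReadFrom-functional α g h (_ , single) {i} {j} {a} {c} {c′} (t₀ , t₁ , e , r) (u₀ , u₁ , e′ , r′)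
  with refl , refl ← pair-injective t₀ t₁ u₀ u₁ (single (code (stem a [])) (pair t₀ t₁) (pair u₀ u₁) (i , e) (j , e′))
  = Reads-functional c c′ r r′

-- Correctness of the translations

module Correctness (g h T : ℕ → ℕ) (∈T⇔Member : ∀ σ → σ ∈ T ⇔ Member g h σ) where

  open Tree g h T ∈T⇔Member

  Pγ : ℕ → ℕ → Set
  Pγ s ℓ = Perfect.γ s ℓ ([] , T ∷ [])

  Pθ : ℕ → ℕ → ℕ → Set
  Pθ s v ℓ = Perfect.θ s v ℓ ([] , T ∷ [])

  Uγ : ℕ → ℕ → Set
  Uγ a b = Form.γ (form universal) a b ([] , g ∷ h ∷ [])

  Uθ : ℕ → ℕ → ℕ → Set
  Uθ a c d = Form.θ (form universal) a c d ([] , g ∷ h ∷ [])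

  Uγ⇒Γ : ∀ a → (∀ b → Uγ a b) → Γ a
  Uγ⇒Γ a u b = from (universal-γ g h a b) (u b)

  Ext⇒Uγ : ∀ a σ → stem a [] ⊑ σ → Ext σ T → ∀ b → Uγ a b
  Ext⇒Uγ a σ p ext b = to (universal-γ g h a b) (ExtAt-stem {σ} a b p (ext (suc b)))

  Uγ⇒Pγ : ∀ a → (∀ b → Uγ a b) → ∀ ℓ → Pγ (code (stem a [])) ℓ
  Uγ⇒Pγ a u ℓ = stem a [] , refl , ExtAt⇒∈ (stem a []) (ext 0) , ext ℓ
    where ext = trunk-Ext {a} (Uγ⇒Γ a u) 0

  Pγ⇒Ext : ∀ s → (∀ ℓ → Pγ s ℓ) → ∃[ σ ] s ≡ code σ × Ext σ T
  Pγ⇒Ext s γs with σ , refl , _ ← γs 0 = σ , refl , γ⇒Ext T σ γs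

  Splits⇒Pθ : ∀ ℓ σ τ₀ τ₁ → Splits ℓ σ τ₀ τ₁ T → Pθ (code σ) (pair (code τ₀) (code τ₁)) ℓ
  Splits⇒Pθ ℓ σ τ₀ τ₁ s = σ , τ₀ , τ₁ , refl , refl , s

  Pθ⇒Splits : ∀ ℓ s v → Pθ s v ℓ → Splits ℓ (decode s) (decode (π₁ v)) (decode (π₂ v)) T
  Pθ⇒Splits ℓ s v = from (splits⇔θ s v ℓ T)

  on-trunk : ∀ a n c → (∀ b → Uγ a b) → (∀ d → Uθ a c d) →
             ∀ ℓ → Pθ (code (trunk a n)) (branch a n c) ℓ
  on-trunk a n c u t ℓ = Splits⇒Pθ ℓ (trunk a n) (trunk a (suc (pair c n))) (limb a (pair c n) [])
    (splits-trunk {a} c n ℓ (Uγ⇒Γ a u) (λ d _ → from (universal-θ g h a c d) (t d)))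

  off-trunk : ∀ σ → ¬ Trunk σ → Ext σ T → ∀ ℓ → Pθ (code σ) (fork σ) ℓ
  off-trunk σ ¬trunk ext ℓ = Splits⇒Pθ ℓ σ (σ ⌢110) (σ ⌢111) (splits-off-trunk ¬trunk ext ℓ)

  -- One level is enough, as `c` depends on `v` alone; the other levels then confirm this same `c`.
  Pθ⇒Reads : ∀ a v ℓ → Pθ (code (stem a [])) v ℓ → ∃[ c ] Reads a (decode (π₁ v)) (decode (π₂ v)) c
  Pθ⇒Reads a v ℓ θ with _ , _ , (p , q) , inc , _ ← Pθ⇒Splits ℓ (code (stem a [])) v θ =
    Reads-exists (subst (_⊑ _) (decode-code (stem a [])) p) (subst (_⊑ _) (decode-code (stem a [])) q) inc

  -- The limb from which `c` is read lies below a string extendible by `suc d` levels, which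
  -- enforces the check of `h` at `d`.
  Reads⇒Uθ : ∀ a s v c d → Reads a (decode (π₁ v)) (decode (π₂ v)) c → Pθ s v (suc d) → Uθ a c d
  Reads⇒Uθ a s v c d r θ with _ , _ , _ , _ , (e₀ , e₁) ← Pθ⇒Splits (suc d) s v θ =
    to (universal-θ g h a c d) (case r of λ
      { (inj₁ (j , p))     → ExtAt-limb {decode (π₁ v)} a c d j p e₀
      ; (inj₂ (_ , j , p)) → ExtAt-limb {decode (π₂ v)} a c d j p e₁
      })

  Pθ? : ∀ s v ℓ → Dec (Pθ s v ℓ)
  Pθ? s v ℓ = map′ (to (splits⇔θ s v ℓ T)) (from (splits⇔θ s v ℓ T)) (decide splits? (T ∷ []) (s ∷ v ∷ ℓ ∷ []))

  private
    U = problem (form universal)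
    P = problem Perfect-bin
    Uᵈ = dual (form universal)
    Pᵈ = dual Perfect-bin
    x : Tuple ⟨ 0 , 2 ⟩
    x = [] , g ∷ h ∷ []
    y : Tuple ⟨ 0 , 1 ⟩
    y = [] , T ∷ []

  true⇔true : Problem.True U x ⇔ Problem.True P y
  true⇔true = mk⇔ forth back
    where
    forth : Problem.True U x → Problem.True P y
    forth u s γs with σ , refl , ext ← Pγ⇒Ext s γs with trunk? σ
    ... | no ¬trunk          = fork σ , off-trunk σ ¬trunk ext
    ... | yes (a , n , refl) with c , t ← u a (Ext⇒Uγ a (trunk a n) (stem-mono-⊑ a []) ext) =
      branch a n c , on-trunk a n c (Ext⇒Uγ a (trunk a n) (stem-mono-⊑ a []) ext) t

    back : Problem.True P y → Problem.True U x
    back p a u with v , t ← p (code (stem a [])) (Uγ⇒Pγ a u) with c , r ← Pθ⇒Reads a v 0 (t 0) =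
      c , λ d → Reads⇒Uθ a (code (stem a [])) v c d r (t (suc d))

  -- A level refuting `v` is found by deciding level 0: either `v` fails there, or it reads some
  -- `c`, and a `d` refuting `c` makes `v` fail at level `suc d`.
  dual-forth : ∀ a → Problem.IsWitness Uᵈ (a ∷ [] , []) x → Problem.IsWitness Pᵈ (code (stem a []) ∷ [] , []) y
  dual-forth a (u , t) = Uγ⇒Pγ a u , λ v → refute v (Pθ? (code (stem a [])) v 0)
    where
    refute : ∀ v → Dec (Pθ (code (stem a [])) v 0) → ∃[ ℓ ] ¬ Pθ (code (stem a [])) v ℓ
    refute v (no ¬θ) = 0 , ¬θ
    refute v (yes θ) with c , r ← Pθ⇒Reads a v 0 θ with d , ¬θ ← t c =
      suc d , λ θ → ¬θ (Reads⇒Uθ a (code (stem a [])) v c d r θ)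

  -- An extendible node off the trunks splits, so a node witnessing the dual lies on the trunk of
  -- some `a`. That its stem lies below the node lets a program recover `a`.
  dual-back : ∀ s → Problem.IsWitness Pᵈ (s ∷ [] , []) y →
              ∃[ a ] stem a [] ⊑ decode s × Problem.IsWitness Uᵈ (a ∷ [] , []) x
  dual-back s (γs , t) with σ , refl , ext ← Pγ⇒Ext s γs with trunk? σ
  ... | no ¬trunk          = let ℓ , ¬θ = t (fork σ) in ⊥-elim (¬θ (off-trunk σ ¬trunk ext ℓ))
  ... | yes (a , n , refl) = a , subst (stem a [] ⊑_) (sym (decode-code (trunk a n))) stem⊑ , u , refute
    where
    stem⊑ : stem a [] ⊑ trunk a n
    stem⊑ = stem-mono-⊑ a []

    u : ∀ b → Uγ a b
    u = Ext⇒Uγ a (trunk a n) stem⊑ ext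

    refute : ∀ c → ∃[ d ] ¬ Uθ a c d
    -- The value that would be right if `c` were an answer fails at some `ℓ`. Only checks below the
    -- code of the padded limb count there, so a bounded search meets a `d` with a nonzero value of
    -- `h`.
    refute c with ℓ , ¬θ ← t (branch a n c)
             with bounded-search (λ d → ¬? (h (pair a (pair c d)) ≟ 0)) (code (limb a (pair c n) (zeros ℓ [])))
    ... | inj₂ (d , _ , h≢0) = d , h≢0 ∘ from (universal-θ g h a c d)
    ... | inj₁ none          = ⊥-elim (¬θ
      (Splits⇒Pθ ℓ (trunk a n) (trunk a (suc (pair c n))) (limb a (pair c n) []) (splits-trunk {a} c n ℓ (Uγ⇒Γ a u)
        (λ d d< → decidable-stable (h (pair a (pair c d)) ≟ 0) (none d d<)))))

  splitting : (ℕ → ℕ) → ℕ → ℕ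
  splitting α i = enumeration SplitBy? (α ∷ g ∷ h ∷ []) (i ∷ [])

  splitting-isWitness : ∀ α → Problem.IsWitness U ([] , α ∷ []) x → Problem.IsWitness P ([] , splitting α ∷ []) y
  splitting-isWitness α (partial , w) =
    enumeration-partial SplitBy? αs []
      (λ {i} {j} {s} {v} {w} → SplitBy-functional α g h partial {i} {j} {s} {v} {w}) ,
    values
    where
    αs = α ∷ g ∷ h ∷ []

    values : ∀ s → (∀ ℓ → Pγ s ℓ) → ∃[ v ] (splitting α ∋ s ↦ v) × (∀ ℓ → Pθ s v ℓ)
    values s γs with σ , refl , ext ← Pγ⇒Ext s γs with trunk? σ
    ... | no ¬trunk = fork σ , from (enumerates SplitBy? αs [] {code σ} {fork σ})
      -- Off the trunks `SplitBy` is independent of the index, and 0 is an arbitrary choice.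
      (0 , inj₂ (subst (λ τ → ¬ Trunk τ) (sym (decode-code σ)) ¬trunk ,
                 cong fork (sym (decode-code σ)))) ,
      off-trunk σ ¬trunk ext
    ... | yes (a , n , refl) with c , (i , e) , t ← w a (Ext⇒Uγ a (trunk a n) (stem-mono-⊑ a []) ext) =
      branch a n c , from (enumerates SplitBy? αs [] {code (trunk a n)} {branch a n c})
        (i , inj₁ (a , n , c , decode-code (trunk a n) , e , refl)) ,
      on-trunk a n c (Ext⇒Uγ a (trunk a n) (stem-mono-⊑ a []) ext) t

  reading : (ℕ → ℕ) → ℕ → ℕ
  reading α i = enumeration ReadFrom? (α ∷ g ∷ h ∷ []) (i ∷ [])

  reading-isWitness : ∀ α → Problem.IsWitness P ([] , α ∷ []) y → Problem.IsWitness U ([] , reading α ∷ []) x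
  reading-isWitness α (partial , w) =
    enumeration-partial ReadFrom? αs []
      (λ {i} {j} {a} {c} {c′} → ReadFrom-functional α g h partial {i} {j} {a} {c} {c′}) ,
    values
    where
    αs = α ∷ g ∷ h ∷ []

    values : ∀ a → (∀ b → Uγ a b) → ∃[ c ] (reading α ∋ a ↦ c) × (∀ d → Uθ a c d)
    values a u with v , (i , e) , t ← w (code (stem a [])) (Uγ⇒Pγ a u)
               with c , r ← Pθ⇒Reads a v 0 (t 0) =
      c , from (enumerates ReadFrom? αs [] {a} {c})
            (i , π₁ v , π₂ v , trans e (cong (λ v → suc (pair (code (stem a [])) v)) (sym (pair-π v))) , r) ,
      λ d → Reads⇒Uθ a (code (stem a [])) v c d r (t (suc d))

-- The reduction of the universal formula to `Perfect-bin`

abstract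
  tree! : ∀ i → Computable ((indicator (∁ Member?) ◂ ε) i)
  tree! = one (indicator! (∁ Member?))

  splitting! : ∀ i → Computable ((enumeration SplitBy? ◂ ε) i)
  splitting! = one (enumeration! SplitBy?)

  reading! : ∀ i → Computable ((enumeration ReadFrom? ◂ ε) i)
  reading! = one (enumeration! ReadFrom?)

  code-stem! : ∀ i → Computable {2} {1} (((λ _ xs → code (stem (lookup xs 0F) [])) ◂ ε) i)
  code-stem! = one (code! (stem! (arg 0F) (const! [])))

module _ (g h : ℕ → ℕ) where

  tree : ℕ → ℕ
  tree n = indicator (∁ Member?) (g ∷ h ∷ []) (n ∷ [])

  ∈-tree : ∀ σ → σ ∈ tree ⇔ Member g h σ
  ∈-tree σ = subst (λ τ → σ ∈ tree ⇔ Member g h τ) (decode-code σ) (indicator∁≡1 Member? (g ∷ h ∷ []) (code σ ∷ []))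

  tree-isTree : IsTree tree
  tree-isTree = (λ n → indicator-≡0∨≡1 (∁ Member?) (g ∷ h ∷ []) (n ∷ [])) ,
                (λ σ τ p → from (∈-tree σ) ∘ Member-⊑ g h p ∘ to (∈-tree τ))

universal≤dm-Perfect-bin : form universal ≤dm Perfect-bin
universal≤dm-Perfect-bin = η ,
  (functional none splitting! , functional none reading! ,
   λ { x@([] , g ∷ h ∷ []) (x! , _) → let open Correctness g h (tree g h) (∈-tree g h) in
     image none tree! x , ↦image none tree! x , instance! x x! ,
     true⇔true ,
     (λ { α@([] , f ∷ []) w → ([] , splitting f ∷ []) , ↦image none splitting! (α ▹ x) , splitting-isWitness f w }) ,
     (λ { α@([] , f ∷ []) w → ([] , reading f ∷ []) , ↦image none reading! (α ▹ x) , reading-isWitness f w }) }) ,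
  (functional code-stem! none , least-stem ,
   λ { x@([] , g ∷ h ∷ []) (x! , _) → let open Correctness g h (tree g h) (∈-tree g h) in
     image none tree! x , ↦image none tree! x , instance! x x! ,
     mk⇔ (λ (a , w) → code (stem a []) , dual-forth a w)
         (λ (s , w) → case dual-back s w of λ (a , _ , w) → a , w) ,
     (λ { α@(a ∷ [] , []) w → (code (stem a []) ∷ [] , []) , ↦image code-stem! none (α ▹ x) , dual-forth a w }) ,
     (λ { α@(s ∷ [] , []) w → case dual-back s w of λ (a , p , w) → (a ∷ [] , []) ,
       ((λ { 0F → search stem-below? p (λ b q → stem-unique b a q p) }) , λ ()) , w }) })
  where
  η : Functional ⟨ 0 , 2 ⟩ ⟨ 0 , 1 ⟩
  η = functional none tree!

  instance! : ∀ x → ComputableTuple x → Problem.IsInstance (problem Perfect-bin) (image none tree! x)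
  instance! x@([] , g ∷ h ∷ []) x! =
    computable-image η {x} {image none tree! x} (↦image none tree! x) x! , tree-isTree g h

  stem-below? : Decidable {2} {2} (λ _ xs → stem (lookup xs 0F) [] ⊑ decode (lookup xs 1F))
  stem-below? = stem! (arg 0F) (const! []) ⊑? decode! (arg 1F)

  -- The search finds the only stem below the given node. It diverges if there is none, which cannot
  -- happen for a witness of the dual.
  least-stem : Functional ⟨ 1 , 2 ⟩ ⟨ 1 , 0 ⟩
  least-stem = record { nums = μ (decider stem-below?) ◂ ε ; funs = ε }

theorem3p30 : Dicomplete Perfect-bin
theorem3p30 = universal , universal-strictly-dicomplete , Perfect-bin≤dm-universal , universal≤dm-Perfect-bin
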